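{- Let $\mu,\nu$ be probability distributions on $\{0,1\}^n$ and let $w$ be a real number. Let $f:\{0,1\}^n\times\{0,1\}^n\to\{0,1\}$ be any function with no monochromatic rectangle of weight greater than $w$ under the product distribution $\mu\times\nu$. Then any linear decision list computing $f$ must have size at least $1/\sqrt{w}$.
   Context: Define $\mathrm{sign}:\mathbb{R}\to\{0,1\}$ by $\mathrm{sign}(x)=1$ if $x>0$ and $\mathrm{sign}(x)=0$ if $x\le 0$. A function $f:\{0,1\}^N\to\{0,1\}$ is a linear threshold function (LTF) if there are real numbers $w_0,w_1,\dots,w_N$ with $f(x)=\mathrm{sign}(w_0+\sum_{i=1}^N w_ix_i)$ for all $x$. A linear decision list of size $k$ on $N$ variables is a sequence $(L_1,a_1),\dots,(L_k,a_k)$ where each $a_i\in\{0,1\}$, each $L_i$ is an LTF on $\{0,1\}^N$ (arbitrary real weights), and $L_k$ is the constant function $1$. It computes the function $f$ given by $f(x)=a_i$, where $i$ is the least index with $L_i(x)=1$. A function on $\{0,1\}^n\times\{0,1\}^n$ is regarded as a function of $N=2n$ Boolean variables. For $b\in\{0,1\}$, a monochromatic $b$-rectangle of $f$ is a pair $(X,Y)$ with $X,Y\subseteq\{0,1\}^n$ and $f(x,y)=b$ for all $(x,y)\in X\times Y$; a monochromatic rectangle is a monochromatic $0$-rectangle or $1$-rectangle. For $X\subseteq\{0,1\}^n$, $\mu(X)=\sum_{x\in X}\mu(x)$. The weight of $(X,Y)$ under $\mu\times\nu$ is $\mu(X)\cdot\nu(Y)$. (Since some single point has positive weight, the hypothesis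 forces $w>0$.) -}

module Defs where

open import Data.Bool.Base using (Bool; true; false; if_then_else_)
open import Data.Fin.Base as Fin using (Fin; toℕ)
open import Data.Integer.Base as ℤ using (+_)
import Data.Integer.Properties as ℤP
open import Data.Nat.Base as ℕ using (ℕ; zero; suc; z≤n; s≤s)
import Data.Nat.Properties as ℕP
import Data.Nat.Coprimality as Coprimality
open import Data.Product.Base using (Σ-syntax; _×_; _,_)
open import Data.Rational.Base as ℚ using (ℚ; mkℚ; 0ℚ; 1ℚ; ½)
import Data.Rational.Properties as ℚP
open import Data.Rational.Solver using (module +-*-Solver)
open import Data.Sum.Base using (_⊎_; inj₁; inj₂)
open import Data.Vec.Base using (Vec; []; _∷_; lookup; take; drop)
import Data.Vec.Functional as Functional
open import Relation.Binary.PropositionalEquality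
open import Relation.Nullary.Decidable.Core using (yes; no)
open import Relation.Nullary.Negation.Core using (¬_)

module Rational where
  open import Data.Rational.Base
  open import Data.Rational.Properties
  open +-*-Solver

  *-pos : ∀ {p q} → 0ℚ < p → 0ℚ < q → 0ℚ < p * q
  *-pos {p} {q} 0<p 0<q =
    positive⁻¹ (p * q) {{pos*pos⇒pos p {{positive 0<p}} q {{positive 0<q}}}}

  *-monoˡ : ∀ {p q r} → 0ℚ ≤ r → p ≤ q → r * p ≤ r * q
  *-monoˡ {r = r} 0≤r = *-monoˡ-≤-nonNeg r {{nonNegative 0≤r}}

  *-monoʳ : ∀ {p q r} → 0ℚ ≤ r → p ≤ q → p * r ≤ q * r
  *-monoʳ {r = r} 0≤r = *-monoʳ-≤-nonNeg r {{nonNegative 0≤r}}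

  *-mono : ∀ {p q r s} → 0ℚ ≤ p → 0ℚ ≤ s → p ≤ q → r ≤ s → p * r ≤ q * s
  *-mono 0≤p 0≤s p≤q r≤s = ≤-trans (*-monoˡ 0≤p r≤s) (*-monoʳ 0≤s p≤q)

  +-nonNeg : ∀ {p q} → 0ℚ ≤ p → 0ℚ ≤ q → 0ℚ ≤ p + q
  +-nonNeg 0≤p 0≤q = +-mono-≤ 0≤p 0≤q

  *-nonNeg : ∀ {p q} → 0ℚ ≤ p → 0ℚ ≤ q → 0ℚ ≤ p * q
  *-nonNeg {p} {q} 0≤p 0≤q = subst (_≤ p * q) (*-zeroʳ p) (*-monoˡ 0≤p 0≤q)

  opaque
    recip : ∀ p → .(0ℚ < p) → ℚ
    recip p 0<p = (1/ p) {{pos⇒nonZero p {{positive 0<p}}}}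

    recip-inverse : ∀ p .(0<p : 0ℚ < p) → p * recip p 0<p ≡ 1ℚ
    recip-inverse p 0<p = *-inverseʳ p {{pos⇒nonZero p {{positive 0<p}}}}

    recip-pos : ∀ p .(0<p : 0ℚ < p) → 0ℚ < recip p 0<p
    recip-pos p 0<p = positive⁻¹ _ {{1/pos⇒pos p {{positive 0<p}}}}

  ½-pos : ∀ {p} → 0ℚ < p → 0ℚ < ½ * p
  ½-pos = *-pos (positive⁻¹ ½)

  ½+½ : ∀ p → ½ * p + ½ * p ≡ p
  ½+½ = solve 1 (λ p → con ½ :* p :+ con ½ :* p := p) refl

  p≤p+q : ∀ {p q} → 0ℚ ≤ q → p ≤ p + q
  p≤p+q {p} {q} 0≤q = subst (_≤ p + q) (+-identityʳ p) (+-monoʳ-≤ p 0≤q)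

  p≤∣p∣ : ∀ p → p ≤ ∣ p ∣
  p≤∣p∣ p with ≤-total 0ℚ p
  ... | inj₁ 0≤p = ≤-reflexive (sym (0≤p⇒∣p∣≡p 0≤p))
  ... | inj₂ p≤0 = ≤-trans p≤0 (0≤∣p∣ p)

  dist-≤ : ∀ {p q ε} → p ≤ q + ε → q ≤ p + ε → ∣ p - q ∣ ≤ ε
  dist-≤ {p} {q} {ε} p≤ q≤ with ∣p∣≡p∨∣p∣≡-p (p - q)
  ... | inj₁ eq = subst₂ _≤_ (sym eq)
        (solve 2 (λ q ε → (q :+ ε) :- q := ε) refl q ε) (+-monoˡ-≤ (- q) p≤)
  ... | inj₂ eq = subst₂ _≤_
        (trans (solve 2 (λ p q → q :- p := :- (p :- q)) refl p q) (sym eq))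
        (solve 2 (λ p ε → (p :+ ε) :- p := ε) refl p ε) (+-monoˡ-≤ (- p) q≤)

  dist-upper : ∀ {p q ε} → ∣ p - q ∣ ≤ ε → p ≤ q + ε
  dist-upper {p} {q} {ε} d = subst (_≤ q + ε)
    (solve 2 (λ p q → q :+ (p :- q) := p) refl p q)
    (+-monoʳ-≤ q (≤-trans (p≤∣p∣ (p - q)) d))

  dist-sym : ∀ p q → ∣ p - q ∣ ≡ ∣ q - p ∣
  dist-sym p q = trans (sym (∣-p∣≡∣p∣ (p - q)))
    (cong ∣_∣ (solve 2 (λ p q → :- (p :- q) := q :- p) refl p q))

  dist-lower : ∀ {p q ε} → ∣ p - q ∣ ≤ ε → q ≤ p + ε
  dist-lower {p} {q} {ε} d = dist-upper (subst (_≤ ε) (dist-sym p q) d)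

  square-mono : ∀ {p q} → 0ℚ ≤ p → p ≤ q → p * p ≤ q * q
  square-mono 0≤p p≤q = *-mono 0≤p (≤-trans 0≤p p≤q) p≤q p≤q

  fromℕℚ : ℕ → ℚ
  fromℕℚ zero    = 0ℚ
  fromℕℚ (suc k) = 1ℚ + fromℕℚ k

  private
    over1 : ℕ → ℚ
    over1 k = mkℚ (+ k) 0 (Coprimality.sym (Coprimality.1-coprimeTo k))

    over1-suc : ∀ k → over1 (suc k) ≡ 1ℚ + over1 k
    over1-suc k = begin
      over1 (suc k)                          ≡⟨ ↥p/↧p≡p (over1 (suc k)) ⟨
      + suc k / 1                            ≡⟨ cong (λ i → (+ 1 ℤ.+ i) / 1) (ℤP.*-identityʳ (+ k)) ⟨
      (+ 1 ℤ.+ + k ℤ.* + 1) / 1              ≡⟨⟩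
      1ℚ + over1 k                           ∎
      where open ≡-Reasoning

    fromℕℚ≡over1 : ∀ k → fromℕℚ k ≡ over1 k
    fromℕℚ≡over1 zero    = refl
    fromℕℚ≡over1 (suc k) = trans (cong (λ z → 1ℚ + z) (fromℕℚ≡over1 k)) (sym (over1-suc k))

    ≤over1 : ∀ p → p ≤ over1 ℤ.∣ ↥ p ∣
    ≤over1 p@(mkℚ (+ a) b _) = *≤* (ℤP.*-monoˡ-≤-nonNeg (+ a) {+ 1} {+ suc b} (ℤ.+≤+ (s≤s z≤n)))
    ≤over1 p@(mkℚ ℤ.-[1+ a ] b _) = *≤* ℤ.-≤+

  archimedean : ∀ p → Σ[ k ∈ ℕ ] p ≤ fromℕℚ k
  archimedean p = ℤ.∣ ↥ p ∣ , subst (p ≤_) (sym (fromℕℚ≡over1 ℤ.∣ ↥ p ∣)) (≤over1 p)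

  mesh : ℕ → ℚ
  mesh n = mkℚ (+ 1) n (Coprimality.1-coprimeTo (suc n))

  mesh-pos : ∀ n → 0ℚ < mesh n
  mesh-pos n = positive⁻¹ (mesh n)

  mesh-small : ∀ ε → 0ℚ < ε → Σ[ N ∈ ℕ ] ∀ n → N ℕ.≤ n → mesh n ≤ ε
  mesh-small (mkℚ (+ 0) b c) 0<ε with mkℚ (+ 0) b c | positive 0<ε
  ... | _ | ()
  mesh-small (mkℚ (+ suc a) b _) 0<ε = b , λ n b≤n →
    *≤* (ℤ.+≤+ (ℕP.*-mono-≤ (s≤s (z≤n {a})) (s≤s b≤n)))
  mesh-small (mkℚ ℤ.-[1+ a ] b c) 0<ε with positive 0<ε
  ... | ()

  0≤fromℕℚ : ∀ k → 0ℚ ≤ fromℕℚ k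
  0≤fromℕℚ zero    = ≤-refl
  0≤fromℕℚ (suc k) = +-nonNeg (nonNegative⁻¹ 1ℚ) (0≤fromℕℚ k)

  p<p+q : ∀ {p q} → 0ℚ < q → p < p + q
  p<p+q {p} {q} 0<q = subst (_< p + q) (+-identityʳ p) (+-monoʳ-< p 0<q)

module Sequences where
  open import Data.Rational.Base
  open import Data.Rational.Properties
  open +-*-Solver
  open Rational

  Cauchy : (ℕ → ℚ) → Set
  Cauchy x = ∀ ε → 0ℚ < ε →
    Σ[ N ∈ ℕ ] ∀ m n → N ℕ.≤ m → N ℕ.≤ n → ∣ x m - x n ∣ ≤ ε

  const-cauchy : ∀ q → Cauchy (λ _ → q)
  const-cauchy q ε 0<ε = 0 , λ _ _ _ _ →
    subst (_≤ ε) (cong ∣_∣ (sym (+-inverseʳ q))) (<⇒≤ 0<ε)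

  +-cauchy : ∀ {x y} → Cauchy x → Cauchy y → Cauchy (λ n → x n + y n)
  +-cauchy {x} {y} cx cy ε 0<ε with cx (½ * ε) (½-pos 0<ε) | cy (½ * ε) (½-pos 0<ε)
  ... | N , x-close | M , y-close = N ℕ.⊔ M , λ m n N⊔M≤m N⊔M≤n → begin
    ∣ (x m + y m) - (x n + y n) ∣      ≡⟨ cong ∣_∣ (regroup (x m) (y m) (x n) (y n)) ⟩
    ∣ (x m - x n) + (y m - y n) ∣      ≤⟨ ∣p+q∣≤∣p∣+∣q∣ (x m - x n) (y m - y n) ⟩
    ∣ x m - x n ∣ + ∣ y m - y n ∣      ≤⟨ +-mono-≤
        (x-close m n (ℕP.m⊔n≤o⇒m≤o N M N⊔M≤m) (ℕP.m⊔n≤o⇒m≤o N M N⊔M≤n))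
        (y-close m n (ℕP.m⊔n≤o⇒n≤o N M N⊔M≤m) (ℕP.m⊔n≤o⇒n≤o N M N⊔M≤n)) ⟩
    ½ * ε + ½ * ε                      ≡⟨ ½+½ ε ⟩
    ε                                  ∎
    where
    open ≤-Reasoning
    regroup : ∀ a b c d → (a + b) - (c + d) ≡ (a - c) + (b - d)
    regroup = solve 4 (λ a b c d → (a :+ b) :- (c :+ d) := (a :- c) :+ (b :- d)) refl

  eventually-bounded : ∀ {x} → Cauchy x →
    Σ[ B ∈ ℚ ] 0ℚ < B × Σ[ N ∈ ℕ ] ∀ n → N ℕ.≤ n → ∣ x n ∣ ≤ B
  eventually-bounded {x} cx with cx 1ℚ (positive⁻¹ 1ℚ)
  ... | N , close = ∣ x N ∣ + 1ℚ , +-mono-≤-< (0≤∣p∣ (x N)) (positive⁻¹ 1ℚ) , N , λ n N≤n → begin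
    ∣ x n ∣                      ≡⟨ cong ∣_∣ (split (x n) (x N)) ⟩
    ∣ x N + (x n - x N) ∣        ≤⟨ ∣p+q∣≤∣p∣+∣q∣ (x N) (x n - x N) ⟩
    ∣ x N ∣ + ∣ x n - x N ∣      ≤⟨ +-monoʳ-≤ ∣ x N ∣ (close n N N≤n ℕP.≤-refl) ⟩
    ∣ x N ∣ + 1ℚ                 ∎
    where
    open ≤-Reasoning
    split : ∀ p q → p ≡ q + (p - q)
    split = solve 2 (λ p q → p := q :+ (p :- q)) refl

  scaled : ∀ {B} .(0<B : 0ℚ < B) ε → B * (ε * recip B 0<B) ≡ ε
  scaled {B} 0<B ε = trans
    (solve 3 (λ b e r → b :* (e :* r) := e :* (b :* r)) refl B ε (recip B 0<B))
    (trans (cong (ε *_) (recip-inverse B 0<B)) (*-identityʳ ε))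

  product-close : ∀ {a b c d A B η} → 0ℚ ≤ η → ∣ a ∣ ≤ A → ∣ d ∣ ≤ B →
    ∣ a - c ∣ ≤ η → ∣ b - d ∣ ≤ η → ∣ a * b - c * d ∣ ≤ (A + B) * η
  product-close {a} {b} {c} {d} {A} {B} {η} 0≤η a≤A d≤B a-c≤η b-d≤η = begin
    ∣ a * b - c * d ∣                            ≡⟨ cong ∣_∣ (regroup a b c d) ⟩
    ∣ a * (b - d) + d * (a - c) ∣                ≤⟨ ∣p+q∣≤∣p∣+∣q∣ (a * (b - d)) (d * (a - c)) ⟩
    ∣ a * (b - d) ∣ + ∣ d * (a - c) ∣            ≡⟨ cong₂ _+_ (∣p*q∣≡∣p∣*∣q∣ a (b - d)) (∣p*q∣≡∣p∣*∣q∣ d (a - c)) ⟩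
    ∣ a ∣ * ∣ b - d ∣ + ∣ d ∣ * ∣ a - c ∣        ≤⟨ +-mono-≤ (*-mono (0≤∣p∣ a) 0≤η a≤A b-d≤η) (*-mono (0≤∣p∣ d) 0≤η d≤B a-c≤η) ⟩
    A * η + B * η                                ≡⟨ *-distribʳ-+ η A B ⟨
    (A + B) * η                                  ∎
    where
    open ≤-Reasoning
    regroup : ∀ a b c d → a * b - c * d ≡ a * (b - d) + d * (a - c)
    regroup = solve 4 (λ a b c d → a :* b :- c :* d := a :* (b :- d) :+ d :* (a :- c)) refl

  scale : ∀ {C ε} → 0ℚ < C → 0ℚ < ε → Σ[ η ∈ ℚ ] 0ℚ < η × C * η ≡ ε
  scale {C} {ε} 0<C 0<ε = ε * recip C 0<C , *-pos 0<ε (recip-pos C 0<C) , scaled 0<C ε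

  +-pos : ∀ {p q} → 0ℚ < p → 0ℚ < q → 0ℚ < p + q
  +-pos 0<p 0<q = +-mono-< 0<p 0<q

  *-cauchy : ∀ {x y} → Cauchy x → Cauchy y → Cauchy (λ n → x n * y n)
  *-cauchy {x} {y} cx cy ε 0<ε =
    let (A , 0<A , K , x-bound) = eventually-bounded {x} cx
        (B , 0<B , L , y-bound) = eventually-bounded {y} cy
        (η , 0<η , eq)          = scale {A + B} {ε} (+-pos {A} {B} 0<A 0<B) 0<ε
        (M , x-close)           = cx η 0<η
        (N , y-close)           = cy η 0<η
    in (K ℕ.⊔ L) ℕ.⊔ (M ℕ.⊔ N) , λ m n big-m big-n →
      let m≥K⊔L = ℕP.m⊔n≤o⇒m≤o (K ℕ.⊔ L) (M ℕ.⊔ N) big-m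
          m≥M⊔N = ℕP.m⊔n≤o⇒n≤o (K ℕ.⊔ L) (M ℕ.⊔ N) big-m
          n≥K⊔L = ℕP.m⊔n≤o⇒m≤o (K ℕ.⊔ L) (M ℕ.⊔ N) big-n
          n≥M⊔N = ℕP.m⊔n≤o⇒n≤o (K ℕ.⊔ L) (M ℕ.⊔ N) big-n
      in subst (λ z → ∣ x m * y m - x n * y n ∣ ≤ z) eq
        (product-close {x m} {y m} {x n} {y n} {A} {B} {η} (<⇒≤ 0<η)
          (x-bound m (ℕP.m⊔n≤o⇒m≤o K L m≥K⊔L)) (y-bound n (ℕP.m⊔n≤o⇒n≤o K L n≥K⊔L))
          (x-close m n (ℕP.m⊔n≤o⇒m≤o M N m≥M⊔N) (ℕP.m⊔n≤o⇒m≤o M N n≥M⊔N))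
          (y-close m n (ℕP.m⊔n≤o⇒n≤o M N m≥M⊔N) (ℕP.m⊔n≤o⇒n≤o M N n≥M⊔N)))

  ⊔-pos : ∀ {δ} → 0ℚ < δ → ∀ q → 0ℚ < δ ⊔ q
  ⊔-pos {δ} 0<δ q = <-≤-trans 0<δ (p≤p⊔q δ q)

  -- Agrees with n ↦ 1 / x n as soon as x n ≥ δ.
  recipSeq : (ℕ → ℚ) → ∀ δ → 0ℚ < δ → ℕ → ℚ
  recipSeq x δ 0<δ n = recip (δ ⊔ x n) (⊔-pos 0<δ (x n))

  recip-anti : ∀ {p q} (0<p : 0ℚ < p) (0<q : 0ℚ < q) → p ≤ q → recip q 0<q ≤ recip p 0<p
  recip-anti {p} {q} 0<p 0<q p≤q = begin
    q⁻¹                  ≡⟨ *-identityʳ q⁻¹ ⟨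
    q⁻¹ * 1ℚ             ≡⟨ cong (q⁻¹ *_) (recip-inverse p 0<p) ⟨
    q⁻¹ * (p * p⁻¹)      ≤⟨ *-monoˡ (<⇒≤ (recip-pos q 0<q)) (*-monoʳ (<⇒≤ (recip-pos p 0<p)) p≤q) ⟩
    q⁻¹ * (q * p⁻¹)      ≡⟨ solve 3 (λ a b c → a :* (b :* c) := (b :* a) :* c) refl q⁻¹ q p⁻¹ ⟩
    (q * q⁻¹) * p⁻¹      ≡⟨ cong (_* p⁻¹) (recip-inverse q 0<q) ⟩
    1ℚ * p⁻¹             ≡⟨ *-identityˡ p⁻¹ ⟩
    p⁻¹                  ∎
    where
    open ≤-Reasoning
    p⁻¹ = recip p 0<p
    q⁻¹ = recip q 0<q

  recip-inverse-⊔ : ∀ x δ (0<δ : 0ℚ < δ) n → δ ≤ x n → x n * recipSeq x δ 0<δ n ≡ 1ℚ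
  recip-inverse-⊔ x δ 0<δ n δ≤x =
    trans (cong (_* recipSeq x δ 0<δ n) (sym (p≤q⇒p⊔q≡q δ≤x)))
          (recip-inverse (δ ⊔ x n) (⊔-pos 0<δ (x n)))

  recip-cauchy : ∀ {x} δ (0<δ : 0ℚ < δ) N → (∀ n → N ℕ.≤ n → δ ≤ x n) →
    Cauchy x → Cauchy (recipSeq x δ 0<δ)
  recip-cauchy {x} δ 0<δ N x≥δ cx ε 0<ε =
    let (M , close) = cx (δ * (δ * ε)) (*-pos 0<δ (*-pos 0<δ 0<ε))
    in N ℕ.⊔ M , λ m n big-m big-n →
      let m≥N = ℕP.m⊔n≤o⇒m≤o N M big-m
          n≥N = ℕP.m⊔n≤o⇒m≤o N M big-n
      in begin
        ∣ u m - u n ∣                              ≡⟨ cong ∣_∣ (difference m n (x≥δ m m≥N) (x≥δ n n≥N)) ⟩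
        ∣ (x n - x m) * (u m * u n) ∣              ≡⟨ ∣p*q∣≡∣p∣*∣q∣ (x n - x m) (u m * u n) ⟩
        ∣ x n - x m ∣ * ∣ u m * u n ∣              ≡⟨ cong (∣ x n - x m ∣ *_) (0≤p⇒∣p∣≡p (*-nonNeg (0≤u m) (0≤u n))) ⟩
        ∣ x n - x m ∣ * (u m * u n)                ≤⟨ *-mono (0≤∣p∣ (x n - x m)) (*-nonNeg 0≤v 0≤v)
                                                        (close n m (ℕP.m⊔n≤o⇒n≤o N M big-n) (ℕP.m⊔n≤o⇒n≤o N M big-m))
                                                        (*-mono (0≤u m) 0≤v (u≤v m) (u≤v n)) ⟩
        (δ * (δ * ε)) * (v * v)                    ≡⟨ solve 3 (λ d e v → (d :* (d :* e)) :* (v :* v) := e :* ((d :* v) :* (d :* v))) refl δ ε v ⟩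
        ε * ((δ * v) * (δ * v))                    ≡⟨ cong (λ z → ε * (z * z)) (recip-inverse δ 0<δ) ⟩
        ε * (1ℚ * 1ℚ)                              ≡⟨ *-identityʳ ε ⟩
        ε                                          ∎
    where
    open ≤-Reasoning
    u = recipSeq x δ 0<δ
    v = recip δ 0<δ
    0≤v = <⇒≤ (recip-pos δ 0<δ)
    0≤u : ∀ n → 0ℚ ≤ u n
    0≤u n = <⇒≤ (recip-pos (δ ⊔ x n) (⊔-pos 0<δ (x n)))
    u≤v : ∀ n → u n ≤ v
    u≤v n = recip-anti 0<δ (⊔-pos 0<δ (x n)) (p≤p⊔q δ (x n))
    difference : ∀ m n → δ ≤ x m → δ ≤ x n → u m - u n ≡ (x n - x m) * (u m * u n)
    difference m n δ≤xm δ≤xn = begin-equality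
      u m - u n                                        ≡⟨ solve 2 (λ a b → a :- b := a :* con 1ℚ :- b :* con 1ℚ) refl (u m) (u n) ⟩
      u m * 1ℚ - u n * 1ℚ                              ≡⟨ cong₂ (λ a b → u m * a - u n * b) (recip-inverse-⊔ x δ 0<δ n δ≤xn) (recip-inverse-⊔ x δ 0<δ m δ≤xm) ⟨
      u m * (x n * u n) - u n * (x m * u m)            ≡⟨ solve 4 (λ a b c d → a :* (c :* b) :- b :* (d :* a) := (c :- d) :* (a :* b)) refl (u m) (u n) (x n) (x m) ⟩
      (x n - x m) * (u m * u n)                        ∎

  -- Rational approximation of √ q from below, with error less than d.
  record Root (q d : ℚ) : Set where
    field
      root   : ℚ
      root≥0 : 0ℚ ≤ root
      below  : 0ℚ ≤ q → root * root ≤ q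
      above  : q < (root + d) * (root + d)

  open Root

  search : ∀ q d → 0ℚ < d → ∀ k → q < (fromℕℚ k * d) * (fromℕℚ k * d) → Root q d
  search q d 0<d zero    q< = record
    { root = 0ℚ ; root≥0 = ≤-refl ; below = λ 0≤q → 0≤q
    ; above = <-trans (subst (q <_) (cong₂ _*_ (*-zeroˡ d) (*-zeroˡ d)) q<)
                (subst (λ z → 0ℚ < z * z) (sym (+-identityˡ d)) (*-pos 0<d 0<d)) }
  search q d 0<d (suc k) q< with (fromℕℚ k * d) * (fromℕℚ k * d) ≤? q
  ... | yes k²≤q = record
    { root = fromℕℚ k * d ; root≥0 = *-nonNeg (0≤fromℕℚ k) (<⇒≤ 0<d) ; below = λ _ → k²≤q
    ; above = subst (λ z → q < z * z)
        (solve 2 (λ k d → (con 1ℚ :+ k) :* d := k :* d :+ d) refl (fromℕℚ k) d) q< }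
  ... | no k²≰q = search q d 0<d k (≰⇒> k²≰q)

  *-self-< : ∀ {b c} → 1ℚ ≤ b → b < c → b < c * c
  *-self-< {b} {c} 1≤b b<c = begin-strict
    b          ≡⟨ *-identityʳ b ⟨
    b * 1ℚ     ≤⟨ *-monoˡ 0≤b 1≤b ⟩
    b * b      ≤⟨ *-monoˡ 0≤b (<⇒≤ b<c) ⟩
    b * c      <⟨ *-monoˡ-<-pos c {{positive (≤-<-trans 0≤b b<c)}} b<c ⟩
    c * c      ∎
    where
    open ≤-Reasoning
    0≤b : 0ℚ ≤ b
    0≤b = ≤-trans (nonNegative⁻¹ 1ℚ) 1≤b

  archimedean-mesh : ∀ p d → 0ℚ < d → Σ[ k ∈ ℕ ] p < fromℕℚ k * d
  archimedean-mesh p d 0<d =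
    let (k , bound) = archimedean (p * recip d 0<d) in suc k , (begin-strict
      p                           ≡⟨ scaled 0<d p ⟨
      d * (p * recip d 0<d)       ≤⟨ *-monoˡ (<⇒≤ 0<d) bound ⟩
      d * fromℕℚ k                <⟨ p<p+q 0<d ⟩
      d * fromℕℚ k + d            ≡⟨ solve 2 (λ d k → d :* k :+ d := (con 1ℚ :+ k) :* d) refl d (fromℕℚ k) ⟩
      fromℕℚ (suc k) * d          ∎)
    where open ≤-Reasoning

  opaque
    root-exists : ∀ q d → 0ℚ < d → Root q d
    root-exists q d 0<d =
      let (k , b<c) = archimedean-mesh (1ℚ ⊔ q) d 0<d
      in search q d 0<d k
        (≤-<-trans (p≤q⊔p 1ℚ q) (*-self-< {1ℚ ⊔ q} {fromℕℚ k * d} (p≤p⊔q 1ℚ q) b<c))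

  rootOf : (x : ℕ → ℚ) → ∀ n → Root (x n) (mesh n)
  rootOf x n = root-exists (x n) (mesh n) (mesh-pos n)

  sqrtSeq : (ℕ → ℚ) → ℕ → ℚ
  sqrtSeq x n = root (rootOf x n)

  root-close : ∀ {p q d e h} (r : Root p d) (s : Root q e) → 0ℚ ≤ p → 0ℚ ≤ h → 0ℚ ≤ e →
    e ≤ h → p ≤ q + h * h → root r ≤ root s + (h + h)
  root-close {p} {q} {d} {e} {h} r s 0≤p 0≤h 0≤e e≤h p≤ = ≮⇒≥ λ s+2h<r → <-irrefl refl (begin-strict
    p                                          ≤⟨ p≤ ⟩
    q + h * h                                  <⟨ +-monoˡ-< (h * h) (above s) ⟩
    (b + e) * (b + e) + h * h                  ≤⟨ +-monoˡ-≤ (h * h) (square-mono (+-nonNeg (root≥0 s) 0≤e) (+-monoʳ-≤ b e≤h)) ⟩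
    (b + h) * (b + h) + h * h                  ≤⟨ p≤p+q (*-nonNeg (+-nonNeg 0≤h 0≤h) (+-nonNeg (root≥0 s) 0≤h)) ⟩
    (b + h) * (b + h) + h * h + (h + h) * (b + h)
      ≡⟨ solve 2 (λ b h → (b :+ h) :* (b :+ h) :+ h :* h :+ (h :+ h) :* (b :+ h)
                   := (b :+ (h :+ h)) :* (b :+ (h :+ h))) refl b h ⟩
    (b + (h + h)) * (b + (h + h))              ≤⟨ square-mono (+-nonNeg (root≥0 s) (+-nonNeg 0≤h 0≤h)) (<⇒≤ s+2h<r) ⟩
    root r * root r                            ≤⟨ below r 0≤p ⟩
    p                                          ∎)
    where
    open ≤-Reasoning
    b = root s

  sqrt-cauchy : ∀ {x} N → (∀ n → N ℕ.≤ n → 0ℚ ≤ x n) → Cauchy x → Cauchy (sqrtSeq x)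
  sqrt-cauchy {x} N x≥0 cx ε 0<ε =
    let h   = ½ * ε
        0<h = ½-pos 0<ε
        (M , close) = cx (h * h) (*-pos 0<h 0<h)
        (L , small) = mesh-small h 0<h
        half : ∀ m n → N ℕ.≤ m → M ℕ.≤ m → M ℕ.≤ n → L ℕ.≤ n → sqrtSeq x m ≤ sqrtSeq x n + ε
        half m n N≤m M≤m M≤n L≤n = subst (λ z → sqrtSeq x m ≤ sqrtSeq x n + z) (½+½ ε)
          (root-close (rootOf x m) (rootOf x n) (x≥0 m N≤m) (<⇒≤ 0<h) (<⇒≤ (mesh-pos n))
            (small n L≤n) (dist-upper (close m n M≤m M≤n)))
    in N ℕ.⊔ (M ℕ.⊔ L) , λ m n big-m big-n →
      let m≥N   = ℕP.m⊔n≤o⇒m≤o N (M ℕ.⊔ L) big-m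
          m≥M⊔L = ℕP.m⊔n≤o⇒n≤o N (M ℕ.⊔ L) big-m
          n≥N   = ℕP.m⊔n≤o⇒m≤o N (M ℕ.⊔ L) big-n
          n≥M⊔L = ℕP.m⊔n≤o⇒n≤o N (M ℕ.⊔ L) big-n
          m≥M   = ℕP.m⊔n≤o⇒m≤o M L m≥M⊔L
          m≥L   = ℕP.m⊔n≤o⇒n≤o M L m≥M⊔L
          n≥M   = ℕP.m⊔n≤o⇒m≤o M L n≥M⊔L
          n≥L   = ℕP.m⊔n≤o⇒n≤o M L n≥M⊔L
      in dist-≤ (half m n m≥N m≥M n≥M n≥L) (half n m n≥N n≥M m≥M m≥L)

  -- B bounds √ q, so that (√ q)² and q differ by less than d (2B + d).
  root-square : ∀ {q d B} (r : Root q d) → 0ℚ ≤ q → 0ℚ ≤ d → d ≤ 1ℚ → root r ≤ B →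
    ∣ root r * root r - q ∣ ≤ (B + B + 1ℚ) * d
  root-square {q} {d} {B} r 0≤q 0≤d d≤1 r≤B = dist-≤
    (≤-trans (below r 0≤q) (p≤p+q (*-nonNeg (+-nonNeg (+-nonNeg 0≤B 0≤B) (nonNegative⁻¹ 1ℚ)) 0≤d)))
    (begin
      q                              ≤⟨ <⇒≤ (above r) ⟩
      (s + d) * (s + d)              ≡⟨ solve 2 (λ s d → (s :+ d) :* (s :+ d) := s :* s :+ (s :+ s :+ d) :* d) refl s d ⟩
      s * s + (s + s + d) * d        ≤⟨ +-monoʳ-≤ (s * s) (*-monoʳ 0≤d (+-mono-≤ (+-mono-≤ r≤B r≤B) d≤1)) ⟩
      s * s + (B + B + 1ℚ) * d       ∎)
    where
    open ≤-Reasoning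
    s = root r
    0≤B : 0ℚ ≤ B
    0≤B = ≤-trans (root≥0 r) r≤B

  sqrt-square : ∀ {x} N → (∀ n → N ℕ.≤ n → 0ℚ ≤ x n) → Cauchy x → ∀ ε → 0ℚ < ε →
    Σ[ K ∈ ℕ ] ∀ n → K ℕ.≤ n → ∣ sqrtSeq x n * sqrtSeq x n - x n ∣ ≤ ε
  sqrt-square {x} N x≥0 cx ε 0<ε =
    let (B , 0<B , K , s≤B) = eventually-bounded (sqrt-cauchy N x≥0 cx)
        C     = B + B + 1ℚ
        0<C   = +-mono-< (+-mono-< 0<B 0<B) (positive⁻¹ 1ℚ)
        (L , small)  = mesh-small (ε * recip C 0<C) (*-pos 0<ε (recip-pos C 0<C))
        (L′ , small′) = mesh-small 1ℚ (positive⁻¹ 1ℚ)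
    in (N ℕ.⊔ K) ℕ.⊔ (L ℕ.⊔ L′) , λ n big →
      let n≥N⊔K  = ℕP.m⊔n≤o⇒m≤o (N ℕ.⊔ K) (L ℕ.⊔ L′) big
          n≥L⊔L′ = ℕP.m⊔n≤o⇒n≤o (N ℕ.⊔ K) (L ℕ.⊔ L′) big
      in ≤-trans
        (root-square (rootOf x n) (x≥0 n (ℕP.m⊔n≤o⇒m≤o N K n≥N⊔K)) (<⇒≤ (mesh-pos n))
          (small′ n (ℕP.m⊔n≤o⇒n≤o L L′ n≥L⊔L′))
          (≤-trans (p≤∣p∣ (sqrtSeq x n)) (s≤B n (ℕP.m⊔n≤o⇒n≤o N K n≥N⊔K))))
        (≤-trans (*-monoˡ (<⇒≤ 0<C) (small n (ℕP.m⊔n≤o⇒m≤o L L′ n≥L⊔L′)))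
          (≤-reflexive (scaled 0<C ε)))

  sqrt-pos : ∀ {x} δ → 0ℚ < δ → ∀ N → (∀ n → N ℕ.≤ n → δ ≤ x n) →
    Σ[ η ∈ ℚ ] 0ℚ < η × Σ[ K ∈ ℕ ] ∀ n → K ℕ.≤ n → η ≤ sqrtSeq x n
  sqrt-pos {x} δ 0<δ N x≥δ =
    let (L , small) = mesh-small h 0<h
    in h , 0<h , N ℕ.⊔ L , λ n big → ≮⇒≥ λ s<h → <-irrefl refl (begin-strict
      x n                                          <⟨ above (rootOf x n) ⟩
      (sqrtSeq x n + mesh n) * (sqrtSeq x n + mesh n)
        ≤⟨ square-mono (+-nonNeg (root≥0 (rootOf x n)) (<⇒≤ (mesh-pos n)))
             (+-mono-≤ (<⇒≤ s<h) (small n (ℕP.m⊔n≤o⇒n≤o N L big))) ⟩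
      (h + h) * (h + h)                            ≡⟨ cong (λ z → z * z) (½+½ a) ⟩
      a * a                                        ≤⟨ *-monoˡ (<⇒≤ 0<a) (p⊓q≤p 1ℚ δ) ⟩
      a * 1ℚ                                       ≡⟨ *-identityʳ a ⟩
      a                                            ≤⟨ p⊓q≤q 1ℚ δ ⟩
      δ                                            ≤⟨ x≥δ n (ℕP.m⊔n≤o⇒m≤o N L big) ⟩
      x n                                          ∎)
    where
    open ≤-Reasoning
    a = 1ℚ ⊓ δ
    0<a : 0ℚ < a
    0<a with ⊓-sel 1ℚ δ
    ... | inj₁ eq = subst (0ℚ <_) (sym eq) (positive⁻¹ 1ℚ)
    ... | inj₂ eq = subst (0ℚ <_) (sym eq) 0<δ
    h = ½ * a
    0<h : 0ℚ < h
    0<h = ½-pos 0<a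

  -- Kept from unfolding, as the proof terms are large.
  opaque
    +-closed : ∀ {x y} → Cauchy x → Cauchy y → Cauchy (λ n → x n + y n)
    +-closed {x} {y} = +-cauchy {x} {y}

    *-closed : ∀ {x y} → Cauchy x → Cauchy y → Cauchy (λ n → x n * y n)
    *-closed {x} {y} = *-cauchy {x} {y}

record ℝ : Set where
  constructor mkℝ
  field
    seq    : ℕ → ℚ
    cauchy : Sequences.Cauchy seq

open ℝ public

infix  4 _≈_ _<_ _≤_
infixl 6 _+_
infixl 7 _*_

_≈_ : ℝ → ℝ → Set
x ≈ y = ∀ ε → 0ℚ ℚ.< ε →
  Σ[ N ∈ ℕ ] ∀ n → N ℕ.≤ n → ℚ.∣ seq x n ℚ.- seq y n ∣ ℚ.≤ ε

_<_ : ℝ → ℝ → Set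
x < y = Σ[ ε ∈ ℚ ] 0ℚ ℚ.< ε ×
  Σ[ N ∈ ℕ ] ∀ n → N ℕ.≤ n → seq x n ℚ.+ ε ℚ.≤ seq y n

-- Not (x < y) ⊎ (x ≈ y), which is constructively stronger; classically the
-- two agree.
_≤_ : ℝ → ℝ → Set
x ≤ y = ¬ (y < x)

_+_ : ℝ → ℝ → ℝ
x + y = mkℝ (λ n → seq x n ℚ.+ seq y n) (Sequences.+-closed {seq x} {seq y} (cauchy x) (cauchy y))

_*_ : ℝ → ℝ → ℝ
x * y = mkℝ (λ n → seq x n ℚ.* seq y n) (Sequences.*-closed {seq x} {seq y} (cauchy x) (cauchy y))

fromℚ : ℚ → ℝ
fromℚ q = mkℝ (λ _ → q) (Sequences.const-cauchy q)

0ℝ 1ℝ : ℝ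
0ℝ = fromℚ 0ℚ
1ℝ = fromℚ 1ℚ

fromℕ : ℕ → ℝ
fromℕ zero    = 0ℝ
fromℕ (suc k) = 1ℝ + fromℕ k

drop-0+ : ∀ {δ q} → 0ℚ ℚ.+ δ ℚ.≤ q → δ ℚ.≤ q
drop-0+ {δ} {q} = subst (ℚ._≤ q) (ℚP.+-identityˡ δ)

add-0+ : ∀ {δ q} → δ ℚ.≤ q → 0ℚ ℚ.+ δ ℚ.≤ q
add-0+ {δ} {q} = subst (ℚ._≤ q) (sym (ℚP.+-identityˡ δ))

opaque
  -- The positivity proof is used only for the modulus of convergence.
  √ : ∀ x → 0ℝ < x → ℝ
  √ x (δ , 0<δ , N , x≥δ) = mkℝ (Sequences.sqrtSeq (seq x))
    (Sequences.sqrt-cauchy N (λ n N≤n → ℚP.≤-trans (ℚP.<⇒≤ 0<δ) (drop-0+ (x≥δ n N≤n))) (cauchy x))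

  √-square : ∀ x (x>0 : 0ℝ < x) → √ x x>0 * √ x x>0 ≈ x
  √-square x (δ , 0<δ , N , x≥δ) =
    Sequences.sqrt-square N (λ n N≤n → ℚP.≤-trans (ℚP.<⇒≤ 0<δ) (drop-0+ (x≥δ n N≤n))) (cauchy x)

  √-pos : ∀ x (x>0 : 0ℝ < x) → 0ℝ < √ x x>0
  √-pos x (δ , 0<δ , N , x≥δ) =
    let (η , 0<η , K , s≥η) = Sequences.sqrt-pos {seq x} δ 0<δ N (λ n N≤n → drop-0+ (x≥δ n N≤n))
    in η , 0<η , K , λ n K≤n → add-0+ (s≥η n K≤n)

opaque
  -- By 1/-inverse, independent of the positivity proof up to _≈_.
  1/ : ∀ x → 0ℝ < x → ℝ
  1/ x (δ , 0<δ , N , x≥δ) = mkℝ (Sequences.recipSeq (seq x) δ 0<δ)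
    (Sequences.recip-cauchy {seq x} δ 0<δ N (λ n N≤n → drop-0+ (x≥δ n N≤n)) (cauchy x))

  1/-inverse : ∀ x (x>0 : 0ℝ < x) → x * 1/ x x>0 ≈ 1ℝ
  1/-inverse x (δ , 0<δ , N , x≥δ) ε 0<ε = N , λ n N≤n →
    subst (ℚ._≤ ε)
      (cong (λ z → ℚ.∣ z ℚ.- 1ℚ ∣)
        (sym (Sequences.recip-inverse-⊔ (seq x) δ 0<δ n (drop-0+ (x≥δ n N≤n)))))
      (ℚP.<⇒≤ 0<ε)

1/√ : ∀ x → 0ℝ < x → ℝ
1/√ x x>0 = 1/ (√ x x>0) (√-pos x x>0)

Cube : ℕ → Set
Cube N = Vec Bool N

∑ : ∀ {N} → (Fin N → ℝ) → ℝ
∑ = Functional.foldr _+_ 0ℝ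

bit : Bool → ℝ
bit b = if b then 1ℝ else 0ℝ

-- The graph of sign : ℝ → {0,1}. The order on ℝ is not decidable, so sign
-- is not available as a function.
Sign : ℝ → Bool → Set
Sign x true  = 0ℝ < x
Sign x false = x ≤ 0ℝ

IsLTF : ∀ {N} → (Cube N → Bool) → Set
IsLTF {N} f = Σ[ w₀ ∈ ℝ ] Σ[ w ∈ (Fin N → ℝ) ]
  ∀ x → Sign (w₀ + ∑ (λ i → w i * bit (lookup x i))) (f x)

-- The last query is the constant function 1; in particular k ≥ 1.
record LinearDecisionList (N k : ℕ) : Set where
  field
    query      : Fin k → Cube N → Bool
    answer     : Fin k → Bool
    query-LTF  : ∀ i → IsLTF (query i)
    last       : Fin k
    last-index : suc (toℕ last) ≡ k
    last-true  : ∀ x → query last x ≡ true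

Computes : ∀ {N k} → LinearDecisionList N k → (Cube N → Bool) → Set
Computes {N} {k} D f = ∀ x → Σ[ i ∈ Fin k ]
  query i x ≡ true × (∀ j → j Fin.< i → query j x ≡ false) × f x ≡ answer i
  where open LinearDecisionList D

onPairs : ∀ {n} → (Cube n → Cube n → Bool) → Cube (n ℕ.+ n) → Bool
onPairs {n} f z = f (take n z) (drop n z)

∑Cube : ∀ {n} → (Cube n → ℝ) → ℝ
∑Cube {zero}  g = g []
∑Cube {suc n} g = ∑Cube (λ x → g (false ∷ x)) + ∑Cube (λ x → g (true ∷ x))

record IsDistribution {n} (μ : Cube n → ℝ) : Set where
  field
    nonNegative : ∀ x → 0ℝ ≤ μ x
    total       : ∑Cube μ ≈ 1ℝ

Subset : ℕ → Set
Subset n = Cube n → Bool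

mass : ∀ {n} → (Cube n → ℝ) → Subset n → ℝ
mass μ X = ∑Cube (λ x → if X x then μ x else 0ℝ)

Monochromatic : ∀ {n} → (Cube n → Cube n → Bool) → Subset n → Subset n → Set
Monochromatic f X Y = Σ[ b ∈ Bool ] ∀ x y → X x ≡ true → Y y ≡ true → f x y ≡ b

{-# OPTIONS --safe #-}

-- A linear threshold function on pairs is the sign of a(x) + b(y), so its
-- rows are nested. Rank the rows x ∈ X by size, and take a threshold c with
-- μ{rank ≥ c} ≥ p > μ{rank > c} and a row x₀ of rank c. Either the row of x₀
-- has mass ≥ p in Y, which gives a rectangle of ones with both sides of mass
-- ≥ p, or removing {rank > c} and the row of x₀ leaves a rectangle of zeros
-- and costs at most p on each side. If kp ≤ 1, a list of k queries cannot
-- exhaust the cube this way, so some query answers a monochromatic rectangle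
-- with both sides of mass ≥ p. If k < 1/√w, this applies with a p > √w.
--
-- As the order on ℝ is not decidable, the argument is run on rational weights
-- that approximate μ and ν.
module Submission where

open import Data.Bool.Base using (Bool; true; false; if_then_else_)
open import Data.Bool.Properties using (¬-not)
import Data.Bool.Properties as Bool
open import Data.Empty using (⊥; ⊥-elim)
open import Data.Fin.Base as Fin using (Fin; zero; suc)
open import Data.Nat.Base as ℕ using (ℕ; zero; suc; z≤n; s≤s)
import Data.Nat.Properties as ℕP
open import Data.Product.Base using (Σ-syntax; _×_; _,_; proj₁; proj₂)
open import Data.Sum.Base using (_⊎_; inj₁; inj₂)
open import Data.Vec.Base using ([]; _∷_; lookup; take; drop; _++_)
open import Data.Vec.Properties using (≡-dec; ++-injective; take++drop≡id)
open import Function.Base using (_∘_; case_of_)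
open import Level using (0ℓ)
open import Relation.Binary.PropositionalEquality
open import Relation.Nullary.Decidable using (Dec; yes; no; does; dec-true; _×-dec_)
open import Relation.Nullary.Negation.Core using (¬_; contradiction)
open import Relation.Unary using (Pred; Decidable)
import Defs as R
open import Defs hiding (_≈_; _<_; _≤_; _+_; _*_)

-- Decidable subsets of the cube and their cardinalities.

does-true : ∀ {P : Set} (p? : Dec P) → does p? ≡ true → P
does-true (yes p) _ = p

select : ∀ {n} {P : Pred (Cube n) 0ℓ} → Decidable P → Subset n
select P? x = does (P? x)

-- Bounds the ranks, and later merges the moduli of convergence of all points into one.
bounded : ∀ {n} (g : Cube n → ℕ) → Σ[ B ∈ ℕ ] ∀ x → g x ℕ.≤ B
bounded {zero}  g = g [] , λ { [] → ℕP.≤-refl }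
bounded {suc n} g =
  let (A , g≤A) = bounded (g ∘ (false ∷_))
      (B , g≤B) = bounded (g ∘ (true ∷_))
  in A ℕ.⊔ B , λ { (false ∷ x) → ℕP.≤-trans (g≤A x) (ℕP.m≤m⊔n A B)
                 ; (true  ∷ x) → ℕP.≤-trans (g≤B x) (ℕP.m≤n⊔m A B) }

count : ∀ {n} → Subset n → ℕ
count {zero}  A = if A [] then 1 else 0
count {suc n} A = count (A ∘ (false ∷_)) ℕ.+ count (A ∘ (true ∷_))

count-mono : ∀ {n} {A B : Subset n} → (∀ x → A x ≡ true → B x ≡ true) → count A ℕ.≤ count B
count-mono {zero} {A} {B} A⊆B with A [] in eq
... | false = z≤n
... | true rewrite A⊆B [] eq = ℕP.≤-refl
count-mono {suc n} A⊆B = ℕP.+-mono-≤ (count-mono (A⊆B ∘ (false ∷_))) (count-mono (A⊆B ∘ (true ∷_)))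

count-strict : ∀ {n} {A B : Subset n} → (∀ x → A x ≡ true → B x ≡ true) →
  ∀ x → A x ≡ false → B x ≡ true → count A ℕ.< count B
count-strict A⊆B []          ¬a b rewrite ¬a | b = s≤s z≤n
count-strict A⊆B (false ∷ x) ¬a b =
  ℕP.+-mono-<-≤ (count-strict (A⊆B ∘ (false ∷_)) x ¬a b) (count-mono (A⊆B ∘ (true ∷_)))
count-strict A⊆B (true ∷ x)  ¬a b =
  ℕP.+-mono-≤-< (count-mono (A⊆B ∘ (false ∷_))) (count-strict (A⊆B ∘ (true ∷_)) x ¬a b)

-- Relations with nested rows.

Relation : ℕ → Set
Relation n = Cube n → Cube n → Bool

-- The rows of L are linearly ordered by inclusion.
Chain : ∀ {n} → Relation n → Set
Chain L = ∀ x x′ y y′ → L x y ≡ true → L x′ y′ ≡ true → L x′ y ≡ false → L x y′ ≡ false → ⊥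

-- If `y` were missing from the row of `x′`, nestedness would put that row inside the row of `x`,
-- strictly because of `y`, so `x′` would have the smaller rank.
rank-mono : ∀ {n} {L : Relation n} → Chain L →
  ∀ {x x′ y} → count (L x) ℕ.≤ count (L x′) → L x y ≡ true → L x′ y ≡ true
rank-mono {L = L} chain {x} {x′} {y} ρ≤ρ′ Lxy with L x′ y in eq
... | true  = refl
... | false = contradiction (count-strict row⊆ y eq Lxy) (ℕP.≤⇒≯ ρ≤ρ′)
  where
  row⊆ : ∀ y′ → L x′ y′ ≡ true → L x y′ ≡ true
  row⊆ y′ Lx′y′ with L x y′ in eq′
  ... | true  = refl
  ... | false = ⊥-elim (chain x x′ y y′ Lxy Lx′y′ eq eq′)

Constant : ∀ {n} → Relation n → Bool → Subset n → Subset n → Set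
Constant L b X Y = ∀ x y → X x ≡ true → Y y ≡ true → L x y ≡ b

Inside : ∀ {n} (X Y X′ Y′ : Subset n) → Set
Inside X Y X′ Y′ = (∀ x → X′ x ≡ true → X x ≡ true) × (∀ y → Y′ y ≡ true → Y y ≡ true)

-- The condition of `Computes` detached from the list, so that the induction can drop the first
-- query and shrink the rectangle.
Outcome : ∀ {n k} → (Fin k → Relation n) → (Fin k → Bool) → Cube n → Cube n → Bool → Set
Outcome {k = k} L a x y v = Σ[ i ∈ Fin k ]
  L i x y ≡ true × (∀ j → j Fin.< i → L j x y ≡ false) × v ≡ a i

-- Sums of rationals over the cube.

module Rectangles where
  open import Data.Rational.Base
  open import Data.Rational.Properties
  open import Data.Rational.Solver using (module +-*-Solver)
  open +-*-Solver
  open Rational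

  -- Once the hypotheses are added up to one inequality `a ≤ b`, a linear goal `p ≤ q` is left as a
  -- ring identity for the solver.
  ≤-shift : ∀ {p q a b} → a ≤ b → p + b ≡ q + a → p ≤ q
  ≤-shift {p} {q} {a} {b} a≤b eq = begin
    p              ≡⟨ solve 2 (λ p b → p := (p :+ b) :- b) refl p b ⟩
    (p + b) - b    ≡⟨ cong (_- b) eq ⟩
    (q + a) - b    ≤⟨ +-monoˡ-≤ (- b) (+-monoʳ-≤ q a≤b) ⟩
    (q + b) - b    ≡⟨ solve 2 (λ q b → (q :+ b) :- b := q) refl q b ⟩
    q              ∎
    where open ≤-Reasoning

  ∑ℚ : ∀ {n} → (Cube n → ℚ) → ℚ
  ∑ℚ {zero}  g = g []
  ∑ℚ {suc n} g = ∑ℚ (g ∘ (false ∷_)) + ∑ℚ (g ∘ (true ∷_))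

  ∑ℚ-mono : ∀ {n} {g h : Cube n → ℚ} → (∀ x → g x ≤ h x) → ∑ℚ g ≤ ∑ℚ h
  ∑ℚ-mono {zero}  g≤h = g≤h []
  ∑ℚ-mono {suc n} g≤h = +-mono-≤ (∑ℚ-mono (g≤h ∘ (false ∷_))) (∑ℚ-mono (g≤h ∘ (true ∷_)))

  interchange : ∀ a b c d → (a + b) + (c + d) ≡ (a + c) + (b + d)
  interchange = solve 4 (λ a b c d → (a :+ b) :+ (c :+ d) := (a :+ c) :+ (b :+ d)) refl

  ∑ℚ-+ : ∀ {n} (g h : Cube n → ℚ) → ∑ℚ (λ x → g x + h x) ≡ ∑ℚ g + ∑ℚ h
  ∑ℚ-+ {zero}  g h = refl
  ∑ℚ-+ {suc n} g h = trans
    (cong₂ _+_ (∑ℚ-+ (g ∘ (false ∷_)) (h ∘ (false ∷_))) (∑ℚ-+ (g ∘ (true ∷_)) (h ∘ (true ∷_))))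
    (interchange (∑ℚ (g ∘ (false ∷_))) (∑ℚ (h ∘ (false ∷_))) (∑ℚ (g ∘ (true ∷_))) (∑ℚ (h ∘ (true ∷_))))

  ∑ℚ-nonNeg : ∀ {n} {g : Cube n → ℚ} → (∀ x → 0ℚ ≤ g x) → 0ℚ ≤ ∑ℚ g
  ∑ℚ-nonNeg {zero}  0≤g = 0≤g []
  ∑ℚ-nonNeg {suc n} 0≤g = +-nonNeg (∑ℚ-nonNeg (0≤g ∘ (false ∷_))) (∑ℚ-nonNeg (0≤g ∘ (true ∷_)))

  ∑ℚ-point : ∀ {n} {g : Cube n → ℚ} → (∀ x → 0ℚ ≤ g x) → ∀ x → g x ≤ ∑ℚ g
  ∑ℚ-point 0≤g []          = ≤-refl
  ∑ℚ-point {g = g} 0≤g (false ∷ x) =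
    ≤-trans (∑ℚ-point (0≤g ∘ (false ∷_)) x) (p≤p+q (∑ℚ-nonNeg (0≤g ∘ (true ∷_))))
  ∑ℚ-point {g = g} 0≤g (true ∷ x) =
    ≤-trans (∑ℚ-point (0≤g ∘ (true ∷_)) x)
      (subst (∑ℚ (g ∘ (true ∷_)) ≤_) (+-comm (∑ℚ (g ∘ (true ∷_))) (∑ℚ (g ∘ (false ∷_))))
        (p≤p+q (∑ℚ-nonNeg (0≤g ∘ (false ∷_)))))

  share : ℕ → ℚ → ℚ
  share zero    t = t
  share (suc n) t = share n (½ * t)

  share-pos : ∀ n {t} → 0ℚ < t → 0ℚ < share n t
  share-pos zero    0<t = 0<t
  share-pos (suc n) 0<t = share-pos n (½-pos 0<t)

  ∑ℚ-share : ∀ n t → ∑ℚ {n} (λ _ → share n t) ≡ t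
  ∑ℚ-share zero    t = refl
  ∑ℚ-share (suc n) t = trans (cong₂ _+_ (∑ℚ-share n (½ * t)) (∑ℚ-share n (½ * t))) (½+½ t)

  -- Averaging, one coordinate at a time: of the two halves of the cube, at least one carries half
  -- of `t`.
  heavy-point : ∀ {n} (g : Cube n → ℚ) {t} → t ≤ ∑ℚ g → Σ[ x ∈ Cube n ] share n t ≤ g x
  heavy-point {zero}  g t≤ = [] , t≤
  heavy-point {suc n} g {t} t≤ with ½ * t ≤? ∑ℚ (g ∘ (false ∷_)) | ½ * t ≤? ∑ℚ (g ∘ (true ∷_))
  ... | yes le | _      = let (x , h) = heavy-point (g ∘ (false ∷_)) le in false ∷ x , h
  ... | no _   | yes le = let (x , h) = heavy-point (g ∘ (true ∷_)) le in true ∷ x , h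
  ... | no ¬a  | no ¬b  = contradiction
    (<-≤-trans (subst (_ <_) (½+½ t) (+-mono-< (≰⇒> ¬a) (≰⇒> ¬b))) t≤) (<-irrefl refl)

  -- Masses of subsets under rational weights.

  Weight : ℕ → Set
  Weight n = Σ[ m ∈ (Cube n → ℚ) ] ∀ x → 0ℚ ≤ m x

  restrict : ∀ {n} → (Cube n → ℚ) → Subset n → Cube n → ℚ
  restrict m X x = if X x then m x else 0ℚ

  massℚ : ∀ {n} → Weight n → Subset n → ℚ
  massℚ (m , _) X = ∑ℚ (restrict m X)

  restrict-nonNeg : ∀ {n} ((m , _) : Weight n) (X : Subset n) → ∀ x → 0ℚ ≤ restrict m X x
  restrict-nonNeg (m , 0≤m) X x with X x
  ... | true  = 0≤m x
  ... | false = ≤-refl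

  mass-cover : ∀ {n} (m : Weight n) {X A B : Subset n} →
    (∀ x → X x ≡ true → A x ≡ true ⊎ B x ≡ true) → massℚ m X ≤ massℚ m A + massℚ m B
  mass-cover m@(μ , 0≤μ) {X} {A} {B} cover =
    ≤-trans (∑ℚ-mono pointwise) (≤-reflexive (∑ℚ-+ (restrict μ A) (restrict μ B)))
    where
    pointwise : ∀ x → restrict μ X x ≤ restrict μ A x + restrict μ B x
    pointwise x with X x in eq
    ... | false = +-nonNeg (restrict-nonNeg m A x) (restrict-nonNeg m B x)
    ... | true with cover x eq
    ...   | inj₁ a rewrite a = p≤p+q (restrict-nonNeg m B x)
    ...   | inj₂ b rewrite b = subst (_≤ restrict μ A x + μ x) (+-identityˡ (μ x))
              (+-monoˡ-≤ (μ x) (restrict-nonNeg m A x))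

  mass-mono : ∀ {n} (m : Weight n) {X A : Subset n} →
    (∀ x → X x ≡ true → A x ≡ true) → massℚ m X ≤ massℚ m A
  mass-mono (μ , 0≤μ) {X} {A} X⊆A = ∑ℚ-mono pointwise
    where
    pointwise : ∀ x → restrict μ X x ≤ restrict μ A x
    pointwise x with X x in eq
    ... | false = restrict-nonNeg (μ , 0≤μ) A x
    ... | true rewrite X⊆A x eq = ≤-refl

  mass-inhabited : ∀ {n} (m : Weight n) (X : Subset n) → 0ℚ < massℚ m X → Σ[ x ∈ Cube n ] X x ≡ true
  mass-inhabited {n} (μ , _) X 0<mass with heavy-point (restrict μ X) ≤-refl
  ... | x , h with X x in eq
  ...   | true  = x , eq
  ...   | false = contradiction (<-≤-trans (share-pos n 0<mass) h) (<-irrefl refl)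

  -- Splitting a rectangle by one query.

  module _ {n} (m m′ : Weight n) (p : ℚ) where

    Big : Subset n → Subset n → Set
    Big X Y = p ≤ massℚ m X × p ≤ massℚ m′ Y

    Cheap : (X Y X′ Y′ : Subset n) → Set
    Cheap X Y X′ Y′ = massℚ m X ≤ massℚ m X′ + p × massℚ m′ Y ≤ massℚ m′ Y′ + p

    Dichotomy : Relation n → Subset n → Subset n → Set
    Dichotomy L X Y = Σ[ X′ ∈ Subset n ] Σ[ Y′ ∈ Subset n ] Inside X Y X′ Y′ ×
      ((Constant L true X′ Y′ × Big X′ Y′) ⊎ (Constant L false X′ Y′ × Cheap X Y X′ Y′))

  module _ {n} (m m′ : Weight n) {p : ℚ} (0<p : 0ℚ < p) where

    module _ (X : Subset n) (ρ : Cube n → ℕ) where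

      above? : ∀ c → Decidable (λ x → X x ≡ true × c ℕ.≤ ρ x)
      above? c x = (X x Bool.≟ true) ×-dec (c ℕP.≤? ρ x)

      level? : ∀ c → Decidable (λ x → X x ≡ true × ρ x ≡ c)
      level? c x = (X x Bool.≟ true) ×-dec (ρ x ℕP.≟ c)

      -- `c` is raised while the points of rank above `c` still have mass at least `p`. When this
      -- stops, rank `c` itself has positive mass and supplies `x₀`. Ranks stay below `c + d`, so at
      -- `d = 0` no point is left to carry the mass `p`.
      threshold : ∀ d c → (∀ x → ρ x ℕ.< c ℕ.+ d) → p ≤ massℚ m (select (above? c)) →
        Σ[ x₀ ∈ Cube n ] X x₀ ≡ true × p ≤ massℚ m (select (above? (ρ x₀))) ×
          massℚ m (select (above? (suc (ρ x₀)))) < p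
      threshold zero c ρ<c p≤ =
        let (x , x∈) = mass-inhabited m (select (above? c)) (<-≤-trans 0<p p≤)
        in contradiction (proj₂ (does-true (above? c x) x∈))
             (ℕP.<⇒≱ (subst (ρ x ℕ.<_) (ℕP.+-identityʳ c) (ρ<c x)))
      threshold (suc d) c ρ<c p≤ with p ≤? massℚ m (select (above? (suc c)))
      ... | yes p≤′ = threshold d (suc c) (λ x → subst (ρ x ℕ.<_) (ℕP.+-suc c d) (ρ<c x)) p≤′
      ... | no p≰ =
        let (x₀ , x₀∈) = mass-inhabited m (select (level? c)) level-pos
            (x₀∈X , ρ≡c) = does-true (level? c x₀) x₀∈
        in x₀ , x₀∈X
           , subst (λ c → p ≤ massℚ m (select (above? c))) (sym ρ≡c) p≤
           , subst (λ c → massℚ m (select (above? (suc c))) < p) (sym ρ≡c) (≰⇒> p≰)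
        where
        covered : ∀ x → select (above? c) x ≡ true →
          select (level? c) x ≡ true ⊎ select (above? (suc c)) x ≡ true
        covered x x∈ with does-true (above? c x) x∈
        ... | x∈X , c≤ρ with ρ x ℕP.≟ c
        ...   | yes ρ≡c = inj₁ (dec-true (level? c x) (x∈X , ρ≡c))
        ...   | no  ρ≢c = inj₂ (dec-true (above? (suc c) x) (x∈X , ℕP.≤∧≢⇒< c≤ρ (ρ≢c ∘ sym)))

        level-pos : 0ℚ < massℚ m (select (level? c))
        level-pos = ≰⇒> λ level≤0 → <-irrefl refl (begin-strict
          p                                                           ≤⟨ p≤ ⟩
          massℚ m (select (above? c))                                 ≤⟨ mass-cover m covered ⟩
          massℚ m (select (level? c)) + massℚ m (select (above? (suc c)))
                                                                      <⟨ +-mono-≤-< level≤0 (≰⇒> p≰) ⟩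
          0ℚ + p                                                      ≡⟨ +-identityˡ p ⟩
          p                                                           ∎)
          where open ≤-Reasoning

    -- By `rank-mono`, rows of rank at least that of `x₀` are one wherever its row is one, and rows
    -- of rank at most that of `x₀` are zero wherever its row is zero.
    split : ∀ {L : Relation n} → Chain L → ∀ X Y → Big m m′ p X Y → Dichotomy m m′ p L X Y
    split {L} chain X Y (p≤X , p≤Y)
      -- The search starts at rank 0, where the upper set is all of `X`.
      with threshold X (count ∘ L) (suc (proj₁ (bounded (count ∘ L)))) 0
             (s≤s ∘ proj₂ (bounded (count ∘ L)))
             (≤-trans p≤X (mass-mono m λ x x∈X → dec-true (above? X (count ∘ L) 0 x) (x∈X , z≤n)))
    ... | x₀ , x₀∈X , p≤above , above<p = conclude (p ≤? massℚ m′ (select (one? true)))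
      where
      ρ = count ∘ L

      one? : ∀ b → Decidable (λ y → Y y ≡ true × L x₀ y ≡ b)
      one? b y = (Y y Bool.≟ true) ×-dec (L x₀ y Bool.≟ b)

      below? : Decidable (λ x → X x ≡ true × ρ x ℕ.≤ ρ x₀)
      below? x = (X x Bool.≟ true) ×-dec (ρ x ℕP.≤? ρ x₀)

      X-covered : ∀ x → X x ≡ true →
        select below? x ≡ true ⊎ select (above? X ρ (suc (ρ x₀))) x ≡ true
      X-covered x x∈X = case ρ x ℕP.≤? ρ x₀ of λ
        { (yes ρ≤) → inj₁ (dec-true (below? x) (x∈X , ρ≤))
        ; (no  ρ≰) → inj₂ (dec-true (above? X ρ (suc (ρ x₀)) x) (x∈X , ℕP.≰⇒> ρ≰)) }

      Y-covered : ∀ y → Y y ≡ true → select (one? false) y ≡ true ⊎ select (one? true) y ≡ true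
      Y-covered y y∈Y = case L x₀ y Bool.≟ true of λ
        { (yes one) → inj₂ (dec-true (one? true y) (y∈Y , one))
        ; (no ¬one) → inj₁ (dec-true (one? false y) (y∈Y , ¬-not ¬one)) }

      conclude : Dec (p ≤ massℚ m′ (select (one? true))) → _
      conclude (yes p≤Y₁) = select (above? X ρ (ρ x₀)) , select (one? true)
        , ((λ x → proj₁ ∘ does-true (above? X ρ (ρ x₀) x)) , (λ y → proj₁ ∘ does-true (one? true y)))
        , inj₁ ((λ x y x∈ y∈ → rank-mono chain (proj₂ (does-true (above? X ρ (ρ x₀) x) x∈))
                                 (proj₂ (does-true (one? true y) y∈)))
               , p≤above , p≤Y₁)
      conclude (no p≰Y₁) = select below? , select (one? false)
        , ((λ x → proj₁ ∘ does-true (below? x)) , (λ y → proj₁ ∘ does-true (one? false y)))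
        , inj₂ (zeros
               , ≤-trans (mass-cover m X-covered) (+-monoʳ-≤ (massℚ m (select below?)) (<⇒≤ above<p))
               , ≤-trans (mass-cover m′ Y-covered)
                   (+-monoʳ-≤ (massℚ m′ (select (one? false))) (<⇒≤ (≰⇒> p≰Y₁))))
        where
        zeros : Constant L false (select below?) (select (one? false))
        zeros x y x∈ y∈ = ¬-not λ Lxy → case trans (sym (proj₂ (does-true (one? false y) y∈)))
          (rank-mono chain (proj₂ (does-true (below? x) x∈)) Lxy) of λ ()

    -- Induction on the length of the list.

    unit-≤ : ∀ k → p ≤ fromℕℚ (suc k) * p
    unit-≤ k = subst (p ≤_)
      (solve 2 (λ κ p → p :+ κ :* p := (con 1ℚ :+ κ) :* p) refl (fromℕℚ k) p)
      (p≤p+q (*-nonNeg (0≤fromℕℚ k) (<⇒≤ 0<p)))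

    remaining : ∀ k {s t} → fromℕℚ (suc k) * p ≤ s → s ≤ t + p → fromℕℚ k * p ≤ t
    remaining k {s} {t} kp≤s s≤t+p = ≤-shift (≤-trans kp≤s s≤t+p)
      (solve 3 (λ κ t p → κ :* p :+ (t :+ p) := t :+ (con 1ℚ :+ κ) :* p) refl (fromℕℚ k) t p)

    -- The masses form a budget of `p` per query. A first query that is one on a big rectangle
    -- answers all of it; one that is zero on the remaining rectangle never answers there and is
    -- dropped at the price `p`. A single query left over has to answer every pair.
    big-rectangle : ∀ k (L : Fin (suc k) → Relation n) (a : Fin (suc k) → Bool) → (∀ i → Chain (L i)) →
      (f : Relation n) (X Y : Subset n) →
      (∀ x y → X x ≡ true → Y y ≡ true → Outcome L a x y (f x y)) →
      fromℕℚ (suc k) * p ≤ massℚ m X → fromℕℚ (suc k) * p ≤ massℚ m′ Y →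
      Σ[ X′ ∈ Subset n ] Σ[ Y′ ∈ Subset n ] Monochromatic f X′ Y′ × Big m m′ p X′ Y′
    big-rectangle zero L a chain f X Y computes p≤X p≤Y = X , Y
      , (a zero , λ x y x∈X y∈Y → case computes x y x∈X y∈Y of λ { (zero , _ , _ , eq) → eq })
      , ≤-trans (unit-≤ 0) p≤X , ≤-trans (unit-≤ 0) p≤Y
    big-rectangle (suc k) L a chain f X Y computes kp≤X kp≤Y =
      conclude (split (chain zero) X Y (≤-trans (unit-≤ (suc k)) kp≤X , ≤-trans (unit-≤ (suc k)) kp≤Y))
      where
      conclude : Dichotomy m m′ p (L zero) X Y →
        Σ[ X′ ∈ Subset n ] Σ[ Y′ ∈ Subset n ] Monochromatic f X′ Y′ × Big m m′ p X′ Y′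
      conclude (X′ , Y′ , (X′⊆X , Y′⊆Y) , inj₁ (ones , big)) = X′ , Y′ , (a zero , answered) , big
        where
        answered : ∀ x y → X′ x ≡ true → Y′ y ≡ true → f x y ≡ a zero
        answered x y x∈ y∈ with computes x y (X′⊆X x x∈) (Y′⊆Y y y∈)
        ... | zero  , _ , _ , eq = eq
        ... | suc i , _ , earlier , _ =
          case trans (sym (ones x y x∈ y∈)) (earlier zero (s≤s z≤n)) of λ ()
      conclude (X′ , Y′ , (X′⊆X , Y′⊆Y) , inj₂ (zeros , X≤ , Y≤)) =
        big-rectangle k (L ∘ suc) (a ∘ suc) (chain ∘ suc) f X′ Y′ computes′
          (remaining (suc k) kp≤X X≤) (remaining (suc k) kp≤Y Y≤)
        where
        computes′ : ∀ x y → X′ x ≡ true → Y′ y ≡ true → Outcome (L ∘ suc) (a ∘ suc) x y (f x y)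
        computes′ x y x∈ y∈ with computes x y (X′⊆X x x∈) (Y′⊆Y y y∈)
        ... | zero  , fires , _ , _ = case trans (sym fires) (zeros x y x∈ y∈) of λ ()
        ... | suc i , fires , earlier , eq = i , fires , (λ j j<i → earlier (suc j) (s≤s j<i)) , eq

  -- Inequalities between reals on tails of their sequences.

  Eventually : (ℕ → Set) → Set
  Eventually P = Σ[ N ∈ ℕ ] ∀ j → N ℕ.≤ j → P j

  both : ∀ {P Q : ℕ → Set} → Eventually P → Eventually Q → Eventually (λ j → P j × Q j)
  both (M , p) (N , q) = M ℕ.⊔ N , λ j big →
    p j (ℕP.m⊔n≤o⇒m≤o M N big) , q j (ℕP.m⊔n≤o⇒n≤o M N big)

  map : ∀ {P Q : ℕ → Set} → (∀ {j} → P j → Q j) → Eventually P → Eventually Q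
  map f (N , p) = N , λ j N≤j → f (p j N≤j)

  -- The comparison is decided on a single term, where the sequences are
  -- within ε/8 of their limits.
  compare : ∀ x y {ε} → 0ℚ < ε → Eventually (λ j → seq x j ≤ seq y j + ε) ⊎ (y R.< x)
  compare x y {ε} 0<ε with cauchy x (½ * (½ * (½ * ε))) (½-pos (½-pos (½-pos 0<ε)))
                         | cauchy y (½ * (½ * (½ * ε))) (½-pos (½-pos (½-pos 0<ε)))
  -- The cut-off 3ε/4 leaves room for an error ε/8 of each sequence: later terms of `x` are at most
  -- `ε` above those of `y` in one case, at least ε/2 above them in the other.
  ... | M , x-close | N , y-close = conclude (seq x K ≤? seq y K + (½ * ε + ½ * (½ * ε)))
    where
    K   = M ℕ.⊔ N
    M≤K = ℕP.m≤m⊔n M N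
    N≤K = ℕP.m≤n⊔m M N

    conclude : Dec (seq x K ≤ seq y K + (½ * ε + ½ * (½ * ε))) → _
    conclude (yes xK≤yK) = inj₁ (K , λ j K≤j →
      ≤-shift
        (+-mono-≤ (dist-lower {seq x K} {seq x j} (x-close K j M≤K (ℕP.≤-trans M≤K K≤j)))
        (+-mono-≤ (dist-upper {seq y K} {seq y j} (y-close K j N≤K (ℕP.≤-trans N≤K K≤j))) xK≤yK))
        (solve 5 (λ xj yj xK yK ε → let h = con ½ in
            xj :+ ((xK :+ h :* (h :* (h :* ε))) :+ ((yj :+ h :* (h :* (h :* ε))) :+ (yK :+ (h :* ε :+ h :* (h :* ε)))))
            := (yj :+ ε) :+ (xj :+ (yK :+ xK)))
          refl (seq x j) (seq y j) (seq x K) (seq y K) ε))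
    conclude (no xK≰yK) = inj₂ (½ * ε , ½-pos 0<ε , K , λ j K≤j →
      ≤-shift
        (+-mono-≤ (dist-upper {seq x K} {seq x j} (x-close K j M≤K (ℕP.≤-trans M≤K K≤j)))
        (+-mono-≤ (dist-lower {seq y K} {seq y j} (y-close K j N≤K (ℕP.≤-trans N≤K K≤j))) (<⇒≤ (≰⇒> xK≰yK))))
        (solve 5 (λ xj yj xK yK ε → let h = con ½ in
            (yj :+ h :* ε) :+ ((xj :+ h :* (h :* (h :* ε))) :+ ((yK :+ h :* (h :* (h :* ε))) :+ xK))
            := xj :+ (xK :+ (yj :+ (yK :+ (h :* ε :+ h :* (h :* ε))))))
          refl (seq x j) (seq y j) (seq x K) (seq y K) ε))

  -- The order `≤` on reals is a negated `<`; refuting the strict alternative of `compare` turns it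
  -- into a bound on terms, at the price of `ε`.
  ≤-eventually : ∀ {x y ε} → x R.≤ y → 0ℚ < ε → Eventually (λ j → seq x j ≤ seq y j + ε)
  ≤-eventually {x} {y} x≤y 0<ε with compare x y 0<ε
  ... | inj₁ close = close
  ... | inj₂ y<x   = contradiction y<x x≤y

  -- Threshold functions on pairs.

  linear : ∀ {N} → ℝ → (Fin N → ℝ) → Cube N → ℝ
  linear w₀ w z = w₀ R.+ ∑ (λ i → w i R.* bit (lookup z i))

  -- Both sides are a(x) + b(y) + a(x′) + b(y′). The identity is exact at each index `j`, since the
  -- real operations act termwise.
  ∑-exchange : ∀ {a b} (w : Fin (a ℕ.+ b) → ℝ) (x x′ : Cube a) (y y′ : Cube b) j →
    let S = λ z → seq (∑ (λ i → w i R.* bit (lookup z i))) j in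
    S (x ++ y) + S (x′ ++ y′) ≡ S (x′ ++ y) + S (x ++ y′)
  ∑-exchange w []       []         y y′ j = refl
  ∑-exchange w (c ∷ x) (c′ ∷ x′) y y′ j = begin
    (t c + S (x ++ y)) + (t c′ + S (x′ ++ y′))       ≡⟨ interchange (t c) (S (x ++ y)) (t c′) (S (x′ ++ y′)) ⟩
    (t c + t c′) + (S (x ++ y) + S (x′ ++ y′))       ≡⟨ cong₂ _+_ (+-comm (t c) (t c′)) (∑-exchange (w ∘ suc) x x′ y y′ j) ⟩
    (t c′ + t c) + (S (x′ ++ y) + S (x ++ y′))       ≡⟨ interchange (t c′) (t c) (S (x′ ++ y)) (S (x ++ y′)) ⟩
    (t c′ + S (x′ ++ y)) + (t c + S (x ++ y′))       ∎
    where
    open ≡-Reasoning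
    t = λ c → seq (w zero R.* bit c) j
    S = λ z → seq (∑ (λ i → w (suc i) R.* bit (lookup z i))) j

  linear-exchange : ∀ {a b} (w₀ : ℝ) (w : Fin (a ℕ.+ b) → ℝ) (x x′ : Cube a) (y y′ : Cube b) j →
    seq (linear w₀ w (x ++ y)) j + seq (linear w₀ w (x′ ++ y′)) j ≡
    seq (linear w₀ w (x′ ++ y)) j + seq (linear w₀ w (x ++ y′)) j
  linear-exchange {a} {b} w₀ w x x′ y y′ j = begin
    (c + S (x ++ y)) + (c + S (x′ ++ y′))    ≡⟨ interchange c (S (x ++ y)) c (S (x′ ++ y′)) ⟩
    (c + c) + (S (x ++ y) + S (x′ ++ y′))    ≡⟨ cong (λ t → (c + c) + t) (∑-exchange w x x′ y y′ j) ⟩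
    (c + c) + (S (x′ ++ y) + S (x ++ y′))    ≡⟨ interchange c c (S (x′ ++ y)) (S (x ++ y′)) ⟩
    (c + S (x′ ++ y)) + (c + S (x ++ y′))    ∎
    where
    open ≡-Reasoning
    c = seq w₀ j
    S : Cube (a ℕ.+ b) → ℚ
    S z = seq (∑ (λ i → w i R.* bit (lookup z i))) j

  -- Allowing ε/2 to each of `c` and `d` uses up just the `ε` in `a`, so the `δ` in `b` remains as
  -- the contradiction.
  sum-contradiction : ∀ {a b c d ε δ} → a + b ≡ c + d → 0ℚ < δ →
    0ℚ + ε ≤ a → 0ℚ + δ ≤ b → c ≤ 0ℚ + ½ * ε → d ≤ 0ℚ + ½ * ε → ⊥
  sum-contradiction {a} {b} {c} {d} {ε} {δ} a+b≡c+d 0<δ a≥ b≥ c≤ d≤ =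
    <-irrefl refl (<-≤-trans 0<δ (≤-shift (+-mono-≤ (+-mono-≤ a≥ b≥) (+-mono-≤ c≤ d≤)) (begin
      δ + ((a + b) + ((0ℚ + ½ * ε) + (0ℚ + ½ * ε)))   ≡⟨ cong (λ t → δ + (t + ((0ℚ + ½ * ε) + (0ℚ + ½ * ε)))) a+b≡c+d ⟩
      δ + ((c + d) + ((0ℚ + ½ * ε) + (0ℚ + ½ * ε)))   ≡⟨ solve 4 (λ c d ε δ →
          δ :+ ((c :+ d) :+ ((con 0ℚ :+ con ½ :* ε) :+ (con 0ℚ :+ con ½ :* ε)))
          := con 0ℚ :+ (((con 0ℚ :+ ε) :+ (con 0ℚ :+ δ)) :+ (c :+ d))) refl c d ε δ ⟩
      0ℚ + (((0ℚ + ε) + (0ℚ + δ)) + (c + d))          ∎)))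
    where open ≡-Reasoning

  -- Two incomparable rows would give positive values at (x, y) and (x′, y′) and nonpositive ones at
  -- (x′, y) and (x, y′), yet the two pairs of values have equal sums.
  LTF-chain : ∀ {n} {q : Cube (n ℕ.+ n) → Bool} → IsLTF q → Chain (λ x y → q (x ++ y))
  LTF-chain {n} {q} (w₀ , w , signs) x x′ y y′ q₁ q₂ q₃ q₄ =
    conclude (sign x y q₁) (sign x′ y′ q₂) (sign x′ y q₃) (sign x y′ q₄)
    where
    s : Cube n → Cube n → ℝ
    s x y = linear w₀ w (x ++ y)

    sign : ∀ x y {b} → q (x ++ y) ≡ b → Sign (s x y) b
    sign x y eq = subst (Sign (s x y)) eq (signs (x ++ y))

    conclude : 0ℝ R.< s x y → 0ℝ R.< s x′ y′ → s x′ y R.≤ 0ℝ → s x y′ R.≤ 0ℝ → ⊥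
    conclude (ε , 0<ε , N₁ , pos₁) (δ , 0<δ , N₂ , pos₂) nonpos₃ nonpos₄ =
      let (N , all) = both (both (N₁ , pos₁) (N₂ , pos₂))
            (both (≤-eventually {s x′ y} {0ℝ} nonpos₃ (½-pos 0<ε))
                  (≤-eventually {s x y′} {0ℝ} nonpos₄ (½-pos 0<ε)))
          ((p₁ , p₂) , (p₃ , p₄)) = all N ℕP.≤-refl
      in sum-contradiction {ε = ε} (linear-exchange w₀ w x x′ y y′ N) 0<δ p₁ p₂ p₃ p₄

  take-++ : ∀ {n} (x y : Cube n) → take n (x ++ y) ≡ x
  take-++ {n} x y = proj₁ (++-injective (take n (x ++ y)) x (take++drop≡id n (x ++ y)))

  drop-++ : ∀ {n} (x y : Cube n) → drop n (x ++ y) ≡ y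
  drop-++ {n} x y = proj₂ (++-injective (take n (x ++ y)) x (take++drop≡id n (x ++ y)))

  list-rectangle : ∀ {n k} (m m′ : Weight n) {p} → 0ℚ < p → 1ℚ ≤ ∑ℚ (proj₁ m) → 1ℚ ≤ ∑ℚ (proj₁ m′) →
    fromℕℚ k * p ≤ 1ℚ → (f : Relation n) (D : LinearDecisionList (n ℕ.+ n) k) → Computes D (onPairs f) →
    Σ[ X ∈ Subset n ] Σ[ Y ∈ Subset n ] Monochromatic f X Y × Big m m′ p X Y
  list-rectangle {n} {zero} _ _ _ _ _ _ _ D _ = case LinearDecisionList.last D of λ ()
  list-rectangle {n} {suc k} m m′ {p} 0<p 1≤m 1≤m′ kp≤1 f D computes =
    big-rectangle m m′ 0<p k (λ i x y → query i (x ++ y)) answer (λ i → LTF-chain {n} (query-LTF i)) f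
      (λ _ → true) (λ _ → true) outcome (≤-trans kp≤1 1≤m) (≤-trans kp≤1 1≤m′)
    where
    open LinearDecisionList D
    outcome : ∀ x y → _ → _ → Outcome (λ i x y → query i (x ++ y)) answer x y (f x y)
    outcome x y _ _ with computes (x ++ y)
    ... | i , fires , earlier , eq = i , fires , earlier ,
      trans (cong₂ f (sym (take-++ x y)) (sym (drop-++ x y))) eq

  -- Rational approximation of distributions.

  ∑Cube-seq : ∀ {n} (μ : Cube n → ℝ) j → seq (∑Cube μ) j ≡ ∑ℚ (λ x → seq (μ x) j)
  ∑Cube-seq {zero}  μ j = refl
  ∑Cube-seq {suc n} μ j = cong₂ _+_ (∑Cube-seq (μ ∘ (false ∷_)) j) (∑Cube-seq (μ ∘ (true ∷_)) j)

  -- One-sided on purpose: a total of at least 1 covers the budget of the list, and a lower bound on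
  -- a rational mass passes to the real mass at a loss of `η`.
  Approximation : ∀ {n} → (Cube n → ℝ) → ℚ → Set
  Approximation {n} μ η = Σ[ m ∈ Weight n ] 1ℚ ≤ ∑ℚ (proj₁ m) ×
    (∀ X {t} → t + η ≤ massℚ m X → Eventually (λ j → t ≤ seq (mass μ X) j))

  restrict-seq : ∀ {n} (μ : Cube n → ℝ) X j x →
    seq (if X x then μ x else 0ℝ) j ≡ restrict (λ x → seq (μ x) j) X x
  restrict-seq μ X j x with X x
  ... | true  = refl
  ... | false = refl

  ∑ℚ-cong : ∀ {n} {g h : Cube n → ℚ} → (∀ x → g x ≡ h x) → ∑ℚ g ≡ ∑ℚ h
  ∑ℚ-cong {zero}  g≡h = g≡h []
  ∑ℚ-cong {suc n} g≡h = cong₂ _+_ (∑ℚ-cong (g≡h ∘ (false ∷_))) (∑ℚ-cong (g≡h ∘ (true ∷_)))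

  mass-seq : ∀ {n} (μ : Cube n → ℝ) X j → seq (mass μ X) j ≡ ∑ℚ (restrict (λ x → seq (μ x) j) X)
  mass-seq μ X j = trans (∑Cube-seq (λ x → if X x then μ x else 0ℝ) j) (∑ℚ-cong (restrict-seq μ X j))

  ∑ℚ-+share : ∀ {n} (g : Cube n → ℚ) t → ∑ℚ (λ x → g x + share n t) ≡ ∑ℚ g + t
  ∑ℚ-+share {n} g t = trans (∑ℚ-+ g (λ _ → share n t)) (cong (λ z → ∑ℚ g + z) (∑ℚ-share n t))

  restrict-≤ : ∀ {n} {g h : Cube n → ℚ} {δ} → 0ℚ ≤ δ → (∀ x → g x ≤ h x + δ) →
    ∀ X x → restrict g X x ≤ restrict h X x + δ
  restrict-≤ 0≤δ g≤h X x with X x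
  ... | true  = g≤h x
  ... | false = +-nonNeg ≤-refl 0≤δ

  mass-≤ : ∀ {n} {g h : Cube n → ℚ} {t} → 0ℚ < t → (∀ x → g x ≤ h x + share n t) →
    ∀ X → ∑ℚ (restrict g X) ≤ ∑ℚ (restrict h X) + t
  mass-≤ {n} {g} {h} {t} 0<t g≤h X =
    ≤-trans (∑ℚ-mono (restrict-≤ (<⇒≤ (share-pos n 0<t)) g≤h X)) (≤-reflexive (∑ℚ-+share (restrict h X) t))

  share-+ : ∀ n s t → share n s + share n t ≡ share n (s + t)
  share-+ zero    s t = refl
  share-+ (suc n) s t = trans (share-+ n (½ * s) (½ * t)) (cong (share n) (sym (*-distribˡ-+ ½ s t)))

  module _ {n} {μ : Cube n → ℝ} {η} (0<η : 0ℚ < η) (M : ℕ)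
    (almost-nonNeg : ∀ x → 0ℚ ≤ seq (μ x) M + share n (½ * η))
    (stable : ∀ x j → M ℕ.≤ j → seq (μ x) M ≤ seq (μ x) j + share n (½ * η))
    (total : 1ℚ ≤ seq (∑Cube μ) M + ½ * η) where

    approximate-at : Approximation μ η
    approximate-at = (m , almost-nonNeg) , 1≤∑m , transfer
      where
      -- The added share, η/2 over the whole cube, makes slightly negative terms nonnegative and
      -- lifts the total to at least 1. The other half of `η` covers the drift of the terms after
      -- `M`.
      m : Cube n → ℚ
      m x = seq (μ x) M + share n (½ * η)

      1≤∑m : 1ℚ ≤ ∑ℚ m
      1≤∑m = subst (1ℚ ≤_)
        (trans (cong (_+ ½ * η) (∑Cube-seq μ M)) (sym (∑ℚ-+share (λ x → seq (μ x) M) (½ * η)))) total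

      m-close : ∀ j → M ℕ.≤ j → ∀ x → m x ≤ seq (μ x) j + share n η
      m-close j M≤j x = ≤-trans (+-monoˡ-≤ (share n (½ * η)) (stable x j M≤j))
        (≤-reflexive (trans (+-assoc (seq (μ x) j) (share n (½ * η)) (share n (½ * η)))
          (cong (λ z → seq (μ x) j + z)
            (trans (share-+ n (½ * η) (½ * η)) (cong (share n) (½+½ η))))))

      +-cancel-≤ : ∀ {s t} → t + η ≤ s + η → t ≤ s
      +-cancel-≤ {s} {t} le = ≤-shift le
        (solve 3 (λ t s η → t :+ (s :+ η) := s :+ (t :+ η)) refl t s η)

      transfer : ∀ X {t} → t + η ≤ ∑ℚ (restrict m X) → Eventually (λ j → t ≤ seq (mass μ X) j)
      transfer X {t} t+η≤ = M , λ j M≤j → subst (t ≤_) (sym (mass-seq μ X j))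
        (+-cancel-≤ (≤-trans t+η≤ (mass-≤ 0<η (m-close j M≤j) X)))

  opaque
    approximate : ∀ {n} {μ : Cube n → ℝ} → IsDistribution μ → ∀ {η} → 0ℚ < η → Approximation μ η
    approximate {n} {μ} dist {η} 0<η =
      let 0<δ            = share-pos n (½-pos 0<η)
          nonNeg         = λ x → ≤-eventually {0ℝ} {μ x} (IsDistribution.nonNegative dist x) 0<δ
          close          = λ x → cauchy (μ x) (share n (½ * η)) 0<δ
          (A , nonNeg≤A) = bounded (λ x → proj₁ (nonNeg x))
          (B , close≤B)  = bounded (λ x → proj₁ (close x))
          (C , total)    = IsDistribution.total dist (½ * η) (½-pos 0<η)
          M              = (A ℕ.⊔ B) ℕ.⊔ C
          A⊔B≤M          = ℕP.m≤m⊔n (A ℕ.⊔ B) C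
          A≤M            = ℕP.≤-trans (ℕP.m≤m⊔n A B) A⊔B≤M
          B≤M            = ℕP.≤-trans (ℕP.m≤n⊔m A B) A⊔B≤M
      in approximate-at {n} {μ} 0<η M
           (λ x → proj₂ (nonNeg x) M (ℕP.≤-trans (nonNeg≤A x) A≤M))
           (λ x j M≤j → dist-upper {seq (μ x) M} {seq (μ x) j} (proj₂ (close x) M j
             (ℕP.≤-trans (close≤B x) B≤M) (ℕP.≤-trans (ℕP.≤-trans (close≤B x) B≤M) M≤j)))
           (dist-lower {seq (∑Cube μ) M} {1ℚ} (total M (ℕP.m≤n⊔m (A ℕ.⊔ B) C)))

  -- Heavy rectangles and the positivity of `w`.

  product-lower : ∀ {n} {μ ν : Cube n → ℝ} {X Y t} → 0ℚ ≤ t →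
    Eventually (λ j → t ≤ seq (mass μ X) j) → Eventually (λ j → t ≤ seq (mass ν Y) j) →
    Eventually (λ j → t * t ≤ seq (mass μ X R.* mass ν Y) j)
  product-lower 0≤t μX νY = map (λ { (a , b) → *-mono 0≤t (≤-trans 0≤t b) a b }) (both μX νY)

  0<1 : 0ℚ < 1ℚ
  0<1 = positive⁻¹ 1ℚ

  NoHeavyRectangle : ∀ {n} → (μ ν : Cube n → ℝ) → ℝ → Relation n → Set
  NoHeavyRectangle μ ν w f =
    ∀ X Y → Monochromatic f X Y → ¬ (w R.< mass μ X R.* mass ν Y)

  -- A rectangle of two single points is monochromatic, and heavy points give it weight at least
  -- `h * h`. So `w` cannot stay below half of that, and `compare` then yields positivity.
  weight-pos : ∀ {n} {μ ν : Cube n → ℝ} → IsDistribution μ → IsDistribution ν →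
    ∀ {w f} → NoHeavyRectangle μ ν w f → 0ℝ R.< w
  weight-pos {n} {μ} {ν} distμ distν {w} {f} none =
    conclude (compare w 0ℝ (½-pos (*-pos 0<h 0<h)))
    where
    -- The approximating weight has a point of mass at least 1/2ⁿ; with `η = h`, half of this
    -- survives the transfer to the reals.
    h = ½ * share n 1ℚ
    0<h : 0ℚ < h
    0<h = ½-pos (share-pos n 0<1)

    equals? : ∀ x → Decidable (λ y → y ≡ x)
    equals? x y = ≡-dec Bool._≟_ y x

    heavy-singleton : ∀ {μ : Cube n → ℝ} → IsDistribution μ →
      Σ[ x ∈ Cube n ] Eventually (λ j → h ≤ seq (mass μ (select (equals? x))) j)
    heavy-singleton dist with approximate dist 0<h
    ... | m@(g , _) , 1≤∑ , transfer with heavy-point g 1≤∑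
    ...   | x , share≤ = x , transfer (select (equals? x)) (begin
            h + h                                      ≡⟨ ½+½ (share n 1ℚ) ⟩
            share n 1ℚ                                 ≤⟨ share≤ ⟩
            g x                                        ≡⟨ cong (λ b → if b then g x else 0ℚ) (dec-true (equals? x x) refl) ⟨
            restrict g (select (equals? x)) x          ≤⟨ ∑ℚ-point (restrict-nonNeg m (select (equals? x))) x ⟩
            massℚ m (select (equals? x))               ∎)
      where open ≤-Reasoning

    x₀ = proj₁ (heavy-singleton distμ)
    y₀ = proj₁ (heavy-singleton distν)
    X = select (equals? x₀)
    Y = select (equals? y₀)

    singleton-rectangle : Monochromatic f X Y
    singleton-rectangle = f x₀ y₀ , λ x y x∈ y∈ →
      cong₂ f (does-true (equals? x₀ x) x∈) (does-true (equals? y₀ y) y∈)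

    product≥ : Eventually (λ j → h * h ≤ seq (mass μ X R.* mass ν Y) j)
    product≥ = product-lower {μ = μ} {ν} {X} {Y} (<⇒≤ 0<h)
      (proj₂ (heavy-singleton distμ)) (proj₂ (heavy-singleton distν))

    conclude : Eventually (λ j → seq w j ≤ 0ℚ + ½ * (h * h)) ⊎ (0ℝ R.< w) → 0ℝ R.< w
    conclude (inj₂ 0<w) = 0<w
    conclude (inj₁ small) = contradiction
      (½ * (h * h) , ½-pos (*-pos 0<h 0<h) , map below (both small product≥))
      (none X Y singleton-rectangle)
      where
      below : ∀ {s t} → s ≤ 0ℚ + ½ * (h * h) × h * h ≤ t → s + ½ * (h * h) ≤ t
      below {s} {t} (s≤ , ≤t) = ≤-shift (+-mono-≤ s≤ ≤t)
        (solve 3 (λ s t h → (s :+ con ½ :* h) :+ ((con 0ℚ :+ con ½ :* h) :+ t) := t :+ (s :+ h))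
          refl s t (h * h))

  -- A rational above √w that still fits `k` times into 1.

  fromℕ-seq : ∀ k j → seq (fromℕ k) j ≡ fromℕℚ k
  fromℕ-seq zero    j = refl
  fromℕ-seq (suc k) j = cong (λ z → 1ℚ + z) (fromℕ-seq k j)

  -- Here `s` is near √w and `r` near its inverse. `κ * s` falls short of `s * r` by at least
  -- `e * h`, and the excess of `s * r` over 1 uses at most half of that.
  slack : ∀ {κ e h s r} → 0ℚ ≤ κ → 0ℚ ≤ e → 0ℚ ≤ h → κ + e ≤ r → h ≤ s →
    s * r ≤ 1ℚ + ½ * (e * h) → κ * s + ½ * (e * h) ≤ 1ℚ
  slack {κ} {e} {h} {s} {r} 0≤κ 0≤e 0≤h κ+e≤r h≤s sr≤ = ≤-shift
    (+-mono-≤ (≤-trans (*-monoˡ (≤-trans 0≤h h≤s) κ+e≤r) sr≤) (*-monoˡ 0≤e h≤s))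
    (solve 4 (λ κ e h s →
        (κ :* s :+ con ½ :* (e :* h)) :+ ((con 1ℚ :+ con ½ :* (e :* h)) :+ e :* s)
        := con 1ℚ :+ (s :* (κ :+ e) :+ e :* h))
      refl κ e h s)

  -- `a` is one term of √w and `s` a later one. Going from a + c/2 to a + c raises the square by at
  -- least 3c²/4, which covers the error c²/8 and the wanted margin c²/8.
  square-step : ∀ {a c s v} → 0ℚ ≤ a → 0ℚ ≤ c → 0ℚ ≤ s → s ≤ a + ½ * c →
    v ≤ s * s + ½ * ((½ * c) * (½ * c)) → v + ½ * ((½ * c) * (½ * c)) ≤ (a + c) * (a + c)
  square-step {a} {c} {s} {v} 0≤a 0≤c 0≤s s≤ v≤ = ≤-shift
    (+-mono-≤ (+-mono-≤ v≤ (square-mono 0≤s s≤)) 0≤rest)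
    (solve 4 (λ a c s v →
        (v :+ con ½ :* ((con ½ :* c) :* (con ½ :* c))) :+
          (((s :* s :+ con ½ :* ((con ½ :* c) :* (con ½ :* c))) :+ (a :+ con ½ :* c) :* (a :+ con ½ :* c)) :+
           (a :* c :+ (con ½ :* c) :* c))
        := (a :+ c) :* (a :+ c) :+ ((v :+ s :* s) :+ con 0ℚ))
      refl a c s v)
    where
    0≤rest : 0ℚ ≤ a * c + (½ * c) * c
    0≤rest = +-nonNeg (*-nonNeg 0≤a 0≤c) (*-nonNeg (*-nonNeg (nonNegative⁻¹ ½) 0≤c) 0≤c)

  -- One step of `c` is the rise above √w, the other the loss in approximating the distributions;
  -- the room `θ` pays for both.
  fits : ∀ {κ a c θ} → 0ℚ ≤ c → (κ + κ + 1ℚ) * c ≡ θ → κ * a + θ ≤ 1ℚ → κ * ((a + c) + c) ≤ 1ℚ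
  fits {κ} {a} {c} {θ} 0≤c refl le = ≤-shift (+-mono-≤ le 0≤c)
    (solve 3 (λ κ a c → κ :* ((a :+ c) :+ c) :+ (con 1ℚ :+ c)
        := con 1ℚ :+ ((κ :* a :+ (κ :+ κ :+ con 1ℚ) :* c) :+ con 0ℚ)) refl κ a c)

  -- `q + ε` is the mass `p` of the sides under the approximating weights; `q` is what remains of it
  -- under the distributions, still above √w.
  Gap : ℝ → ℕ → Set
  Gap w k = Σ[ q ∈ ℚ ] Σ[ ε ∈ ℚ ] 0ℚ ≤ q × 0ℚ < ε × fromℕℚ k * (q + ε) ≤ 1ℚ × w R.< fromℚ (q * q)

  gap : ∀ w (w>0 : 0ℝ R.< w) k → fromℕ k R.< 1/√ w w>0 → Gap w k
  gap w w>0 k (e , 0<e , N₁ , k+e≤r) =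
    let (h , 0<h , N₂ , h≤s) = √-pos w w>0
        θ                    = ½ * (e * h)
        0<θ                  = ½-pos (*-pos 0<e 0<h)
        (N₃ , sr≈1)          = 1/-inverse (√ w w>0) (√-pos w w>0) θ 0<θ
        κ                    = fromℕℚ k
        -- The added 1 keeps the divisor positive even when `k` is zero.
        0<C                  = +-mono-≤-< (+-nonNeg (0≤fromℕℚ k) (0≤fromℕℚ k)) 0<1
        (c , 0<c , Cc≡θ)     = Sequences.scale {κ + κ + 1ℚ} {θ} 0<C 0<θ
        (N₄ , s-close)       = cauchy (√ w w>0) (½ * c) (½-pos 0<c)
        d                    = ½ * ((½ * c) * (½ * c))
        0<d                  = ½-pos (*-pos (½-pos 0<c) (½-pos 0<c))
        (N₅ , s²≈w)          = √-square w w>0 d 0<d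
        s                    = seq (√ w w>0)
        r                    = seq (1/√ w w>0)
        M                    = (N₁ ℕ.⊔ N₂) ℕ.⊔ (N₃ ℕ.⊔ N₄)
        M₁₂                  = ℕP.m≤m⊔n (N₁ ℕ.⊔ N₂) (N₃ ℕ.⊔ N₄)
        M₃₄                  = ℕP.m≤n⊔m (N₁ ℕ.⊔ N₂) (N₃ ℕ.⊔ N₄)
        M₁                   = ℕP.m⊔n≤o⇒m≤o N₁ N₂ M₁₂
        M₂                   = ℕP.m⊔n≤o⇒n≤o N₁ N₂ M₁₂
        M₃                   = ℕP.m⊔n≤o⇒m≤o N₃ N₄ M₃₄
        M₄                   = ℕP.m⊔n≤o⇒n≤o N₃ N₄ M₃₄
        0≤s                  = λ {j} (N≤j : N₂ ℕ.≤ j) → ≤-trans (<⇒≤ 0<h) (drop-0+ (h≤s j N≤j))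
    -- Later terms of √w exceed `s M` by at most c/2, so `s M + c` lies strictly above √w.
    in s M + c , c
     , +-nonNeg (0≤s M₂) (<⇒≤ 0<c) , 0<c
     , fits {κ} {s M} {c} {θ} (<⇒≤ 0<c) Cc≡θ
         (slack {κ} {e} {h} {s M} {r M} (0≤fromℕℚ k) (<⇒≤ 0<e) (<⇒≤ 0<h)
           (subst (λ z → z + e ≤ r M) (fromℕ-seq k M) (k+e≤r M M₁))
           (drop-0+ (h≤s M M₂))
           (dist-upper {s M * r M} {1ℚ} (sr≈1 M M₃)))
     , d , 0<d , M ℕ.⊔ N₅ , λ j big →
         let M≤j  = ℕP.m⊔n≤o⇒m≤o M N₅ big
             N₅≤j = ℕP.m⊔n≤o⇒n≤o M N₅ big
         in square-step {s M} {c} {s j} {seq w j} (0≤s M₂) (<⇒≤ 0<c) (0≤s (ℕP.≤-trans M₂ M≤j))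
              (dist-lower {s M} {s j} (s-close M j M₄ (ℕP.≤-trans M₄ M≤j)))
              (dist-lower {s j * s j} {seq w j} (s²≈w j N₅≤j))

  -- The lower bound on the size.

  no-short-list : ∀ {n} {μ ν : Cube n → ℝ} → IsDistribution μ → IsDistribution ν →
    ∀ {w f} → NoHeavyRectangle μ ν w f → ∀ {k} → Gap w k →
    (D : LinearDecisionList (n ℕ.+ n) k) → ¬ Computes D (onPairs f)
  no-short-list {μ = μ} {ν} distμ distν {w} {f} none {k} (q , ε , 0≤q , 0<ε , fit , d , 0<d , w<q²) D computes =
    let (m  , 1≤m  , μ-transfer) = approximate distμ 0<ε
        (m′ , 1≤m′ , ν-transfer) = approximate distν 0<ε
        (X , Y , mono , p≤X , p≤Y) = list-rectangle m m′ {q + ε} (+-mono-≤-< 0≤q 0<ε) 1≤m 1≤m′ fit f D computes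
        -- After the loss of `ε` both sides have mass at least `q`, so the rectangle has weight at
        -- least q², beyond `w`.
        product≥ = product-lower {μ = μ} {ν} {X} {Y} 0≤q (μ-transfer X p≤X) (ν-transfer Y p≤Y)
    in none X Y mono (d , 0<d , map (λ { (w≤ , ≤product) → ≤-trans w≤ ≤product }) (both w<q² product≥))

open import Defs

lemma17 : ∀ (n : ℕ) (μ ν : Cube n → ℝ) →
    IsDistribution μ → IsDistribution ν →
    (w : ℝ) (f : Cube n → Cube n → Bool) →
    (∀ (X Y : Subset n) → Monochromatic f X Y → ¬ (w < mass μ X * mass ν Y)) →
    Σ[ w>0 ∈ 0ℝ < w ]
    (∀ (k : ℕ) (D : LinearDecisionList (n ℕ.+ n) k) →
    Computes D (onPairs f) → 1/√ w w>0 ≤ fromℕ k)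
-- Positivity comes first because `1/√` takes a proof of it; as `≤` is a negation, the bound is a
-- refutation of `k < 1/√w`.
lemma17 n μ ν distμ distν w f none = w>0 , λ k D computes k<1/√w →
  no-short-list distμ distν {w} {f} none (gap w w>0 k k<1/√w) D computes
  where
  open Rectangles
  w>0 = weight-pos distμ distν {w} {f} none
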